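{- For every integer $k\ge1$, there is a deterministic $n^{O(\log k)}$-time reduction from a 3SAT instance on $n$ variables to a linear subspace $\mathcal{L}\subseteq\mathbb{F}_2^{N\times N}$ with $N=n^{O(\log k)}$, such that satisfiable instances yield a nonzero rank-$1$ matrix in $\mathcal{L}$, and unsatisfiable instances yield no nonzero matrix in $\mathcal{L}$ of rank at most $k$.
   Context: 3SAT is the problem of deciding satisfiability of a CNF formula whose clauses each contain three literals. -}

module Defs where

open import Data.Bool.Base using (Bool; true; not)
open import Data.Fin.Base using (Fin; zero; toℕ)
open import Data.List.Base using (List; foldr)
open import Data.List.Relation.Unary.All using (All)
open import Data.List.Relation.Unary.Unique.Propositional using (Unique)
open import Data.Nat.Base using (ℕ; zero; suc; _+_; _*_; _^_; _≤_; _⊔_)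
open import Data.Nat.Logarithm using (⌊log₂_⌋)
open import Data.Parity.Base using (Parity; 0ℙ; 1ℙ)
open import Data.Parity.Properties using (+-*-commutativeRing)
open import Data.Product.Base using (∃; ∃-syntax; _×_; _,_)
open import Data.Vec.Base as Vec using (Vec; _∷_; lookup; replicate; _[_]≔_)
open import Data.Vec.Functional as Vector using (Vector)
open import Data.Vec.Relation.Unary.Any using (Any)
open import Algebra.Bundles using (CommutativeRing)
open import Relation.Binary.PropositionalEquality.Core
  using (_≡_; _≗_; refl; sym; trans)
open import Relation.Nullary.Negation.Core using (¬_)
import Algebra.Definitions.RawMonoid as RawMonoidDefinitions

------------------------------------------------------------------------
-- 3SAT

data Literal (n : ℕ) : Set where
  pos neg : Fin n → Literal n

Clause : ℕ → Set
Clause n = Vec (Literal n) 3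

-- A formula is a set of clauses: a list without repetitions.  Hence the
-- size of a formula is polynomially bounded in the number n of
-- variables, and running times may be measured in n alone.  The three
-- literals of a clause are not required to be distinct, and not every
-- variable has to occur.

record 3CNF (n : ℕ) : Set where
  constructor cnf
  field
    clauses : List (Clause n)
    unique  : Unique clauses

Assignment : ℕ → Set
Assignment n = Fin n → Bool

evalLiteral : ∀ {n} → Assignment n → Literal n → Bool
evalLiteral α (pos x) = α x
evalLiteral α (neg x) = not (α x)

Satisfies : ∀ {n} → Assignment n → 3CNF n → Set
Satisfies α φ = All (Any (λ ℓ → evalLiteral α ℓ ≡ true)) (3CNF.clauses φ)

Satisfiable : ∀ {n} → 3CNF n → Set
Satisfiable φ = ∃[ α ] Satisfies α φ

------------------------------------------------------------------------
-- Linear algebra over the two-element field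

-- Parity, with its ring structure from the library, is the field ℤ/2ℤ.

F₂ : Set
F₂ = Parity

open CommutativeRing +-*-commutativeRing public
  using () renaming (_*_ to _*₂_)
open RawMonoidDefinitions
  (CommutativeRing.+-rawMonoid +-*-commutativeRing) public
  using () renaming (sum to sum₂)

-- The vector space of I-indexed families of scalars, with equality taken
-- entrywise (_≗_).  Column vectors have I = Fin N, and N × N matrices
-- have I = Fin N × Fin N.

Space : Set → Set
Space I = I → F₂

Matrix : ℕ → Set
Matrix N = Space (Fin N × Fin N)

𝟎 : ∀ {I} → Space I
𝟎 _ = 0ℙ

NonZeroVector : ∀ {I} → Space I → Set
NonZeroVector v = ¬ (v ≗ 𝟎)

combination : ∀ {I m} → Vector F₂ m → Vector (Space I) m → Space I
combination a v i = sum₂ (λ j → a j *₂ v j i)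

-- The linear subspace spanned by a finite family.

Span : ∀ {I m} → Vector (Space I) m → Space I → Set
Span v w = ∃[ a ] w ≗ combination a v

LinearlyIndependent : ∀ {I m} → Vector (Space I) m → Set
LinearlyIndependent v = ∀ a → combination a v ≗ 𝟎 → a ≗ 𝟎

-- The subspace W has a basis with r elements.

HasDimension : ∀ {I} → (Space I → Set) → ℕ → Set
HasDimension {I} W r =
  ∃ λ (b : Vector (Space I) r) →
    (∀ j → W (b j)) × LinearlyIndependent b × (∀ w → W w → Span b w)

columns : ∀ {N} → Matrix N → Vector (Space (Fin N)) N
columns M j i = M (i , j)

HasRank : ∀ {N} → Matrix N → ℕ → Set
HasRank M r = HasDimension (Span (columns M)) r

RankAtMost : ∀ {N} → Matrix N → ℕ → Set
RankAtMost M k = ∃[ r ] r ≤ k × HasRank M r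

------------------------------------------------------------------------
-- Deterministic computation

-- The model is Jones' language WHILE (Computability and Complexity from
-- a Programming Perspective, 1997): imperative programs over binary
-- trees, with finitely many registers, each elementary tree operation
-- having unit cost.  It is equivalent to (multi-tape) Turing machines up
-- to a polynomial change of running time.  Tests regard nil as false and
-- all other trees as true.

infixr 5 _∙_
infix  4 _≔_
infixr 3 _⨾_

data Tree : Set where
  nil : Tree
  _∙_ : Tree → Tree → Tree

data Expr (v : ℕ) : Set where
  var   : Fin v → Expr v
  nil   : Expr v
  cons  : Expr v → Expr v → Expr v
  hd tl : Expr v → Expr v

data Command (v : ℕ) : Set where
  skip          : Command v
  _≔_           : Fin v → Expr v → Command v
  _⨾_           : Command v → Command v → Command v
  if_then_else_ : Expr v → Command v → Command v → Command v
  while_loop_   : Expr v → Command v → Command v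

Store : ℕ → Set
Store v = Vec Tree v

head tail : Tree → Tree
head nil     = nil
head (x ∙ _) = x
tail nil     = nil
tail (_ ∙ y) = y

⟦_⟧ : ∀ {v} → Expr v → Store v → Tree
⟦ var x ⟧    s = lookup s x
⟦ nil ⟧      s = nil
⟦ cons e f ⟧ s = ⟦ e ⟧ s ∙ ⟦ f ⟧ s
⟦ hd e ⟧     s = head (⟦ e ⟧ s)
⟦ tl e ⟧     s = tail (⟦ e ⟧ s)

cost : ∀ {v} → Expr v → ℕ
cost (var _)    = 1
cost nil        = 1
cost (cons e f) = suc (cost e + cost f)
cost (hd e)     = suc (cost e)
cost (tl e)     = suc (cost e)

-- c , s ⇓[ t ] s′: started in store s, the command c halts in store s′
-- after time t.

infix 2 _,_⇓[_]_

data _,_⇓[_]_ {v : ℕ} : Command v → Store v → ℕ → Store v → Set where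

  skip : ∀ {s} →
    skip , s ⇓[ 1 ] s

  assign : ∀ {s x e} →
    (x ≔ e) , s ⇓[ suc (cost e) ] (s [ x ]≔ ⟦ e ⟧ s)

  seq : ∀ {c d s s′ s″ t u} →
    c , s ⇓[ t ] s′ → d , s′ ⇓[ u ] s″ →
    (c ⨾ d) , s ⇓[ t + u ] s″

  if-true : ∀ {e c d s s′ t x y} → ⟦ e ⟧ s ≡ x ∙ y →
    c , s ⇓[ t ] s′ →
    (if e then c else d) , s ⇓[ suc (cost e) + t ] s′

  if-false : ∀ {e c d s s′ t} → ⟦ e ⟧ s ≡ nil →
    d , s ⇓[ t ] s′ →
    (if e then c else d) , s ⇓[ suc (cost e) + t ] s′

  while-true : ∀ {e c s s′ s″ t u x y} → ⟦ e ⟧ s ≡ x ∙ y →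
    c , s ⇓[ t ] s′ → (while e loop c) , s′ ⇓[ u ] s″ →
    (while e loop c) , s ⇓[ suc (cost e) + (t + u) ] s″

  while-false : ∀ {e c s} → ⟦ e ⟧ s ≡ nil →
    (while e loop c) , s ⇓[ suc (cost e) ] s

private
  nil≢∙ : ∀ {x y a} {A : Set a} → nil ≡ (x ∙ y) → A
  nil≢∙ ()

-- Computations are deterministic, in result and in time.

deterministic : ∀ {v} {c : Command v} {s s₁ s₂ t₁ t₂} →
  c , s ⇓[ t₁ ] s₁ → c , s ⇓[ t₂ ] s₂ → t₁ ≡ t₂ × s₁ ≡ s₂
deterministic skip skip = refl , refl
deterministic assign assign = refl , refl
deterministic (seq p q) (seq p′ q′)
  with refl , refl ← deterministic p p′
  with refl , refl ← deterministic q q′ = refl , refl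
deterministic (if-true _ p) (if-true _ p′)
  with refl , refl ← deterministic p p′ = refl , refl
deterministic (if-true h _) (if-false h′ _) = nil≢∙ (trans (sym h′) h)
deterministic (if-false h _) (if-true h′ _) = nil≢∙ (trans (sym h) h′)
deterministic (if-false _ p) (if-false _ p′)
  with refl , refl ← deterministic p p′ = refl , refl
deterministic (while-true _ p q) (while-true _ p′ q′)
  with refl , refl ← deterministic p p′
  with refl , refl ← deterministic q q′ = refl , refl
deterministic (while-true h _ _) (while-false h′) = nil≢∙ (trans (sym h′) h)
deterministic (while-false h) (while-true h′ _ _) = nil≢∙ (trans (sym h) h′)
deterministic (while-false _) (while-false _) = refl , refl

record Program : Set where
  field
    {auxiliary} : ℕ
    body        : Command (suc auxiliary)

-- Input and output are held in register zero, the auxiliary registers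
-- being initially nil.

_⟨_⟩⇓[_]_ : Program → Tree → ℕ → Tree → Set
p ⟨ x ⟩⇓[ t ] y =
  ∃[ s ] (body , (x ∷ replicate auxiliary nil) ⇓[ t ] s) × lookup s zero ≡ y
  where open Program p

------------------------------------------------------------------------
-- Encoding of inputs and outputs

encodeList : ∀ {A : Set} → (A → Tree) → List A → Tree
encodeList enc = foldr (λ x t → enc x ∙ t) nil

encodeVector : ∀ {A : Set} → (A → Tree) → ∀ {n} → Vector A n → Tree
encodeVector enc = Vector.foldr (λ x t → enc x ∙ t) nil

-- Numbers are written in unary.

encodeℕ : ℕ → Tree
encodeℕ zero    = nil
encodeℕ (suc n) = nil ∙ encodeℕ n

encodeFin : ∀ {n} → Fin n → Tree
encodeFin i = encodeℕ (toℕ i)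

encodeLiteral : ∀ {n} → Literal n → Tree
encodeLiteral (pos x) = (nil ∙ nil) ∙ encodeFin x
encodeLiteral (neg x) = nil ∙ encodeFin x

encodeClause : ∀ {n} → Clause n → Tree
encodeClause C = encodeList encodeLiteral (Vec.toList C)

encode3CNF : ∀ {n} → 3CNF n → Tree
encode3CNF {n} φ = encodeℕ n ∙ encodeList encodeClause (3CNF.clauses φ)

encodeF₂ : F₂ → Tree
encodeF₂ 0ℙ = nil
encodeF₂ 1ℙ = nil ∙ nil

encodeMatrix : ∀ {N} → Matrix N → Tree
encodeMatrix M = encodeVector (encodeVector encodeF₂) (λ i j → M (i , j))

-- A subspace of the N × N matrices is presented by N and a finite
-- spanning family.

encodeSpan : ∀ {N m} → Vector (Matrix N) m → Tree
encodeSpan {N} B = encodeℕ N ∙ encodeVector encodeMatrix B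

------------------------------------------------------------------------
-- The bound n^{O(log k)}

-- The constant c is the one hidden in the O.  The exponent uses
-- 1 + ⌊log₂ k⌋, which is at most 2 log₂ k for k ≥ 2 and is positive for
-- k = 1; the base is n for n ≥ 2, and 2 for the degenerate n < 2.

bound : (c k n : ℕ) → ℕ
bound c k n = (n ⊔ 2) ^ (c * suc ⌊log₂ k ⌋)

{-# OPTIONS --safe #-}
-- Fix D slightly larger than log₂ k.  A linear functional ℓ on the
-- functions {0,1}ⁿ → F₂ of degree at most 2D has a moment matrix, with
-- entries ℓ(S·T) for products S, T of at most D literals.  Evaluation at a
-- satisfying assignment gives a matrix of rank 1.  Conversely suppose that
-- ℓ ≠ 0 kills all multiples of the products of the negated literals of a
-- clause.  If the formula is unsatisfiable, there is a literal x for which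
-- both ℓ(x·_) and ℓ(¬x·_) are nonzero: either some word w has ℓ(x·w) ≠ 0
-- and ℓ(w) = 0, so that ℓ(¬x·w) ≠ 0, or ℓ(1) = 1, and x occurs in a clause
-- falsified by the assignment read off from the values of ℓ at single
-- literals.  As x·¬x = 0, the moment matrices of ℓ(x·_) and ℓ(¬x·_) are the
-- diagonal blocks of a block triangular submatrix of that of ℓ, so each
-- branching doubles the rank, and the rank exceeds k.
--
-- No linear system has to be solved to present the space of such matrices.
-- All functionals of degree at most L are spanned by the evaluations at
-- points with at most L ones, and the clause conditions are enforced by
-- appending k + 1 copies of the matrix of the forbidden values of ℓ.

module Submission where

open import Defs
open import Algebra.Bundles using (CommutativeRing)
open import Data.Bool.Base using (Bool; true; false; not; _∨_)
import Data.Bool.Properties as Bool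
open import Data.Fin.Base using (Fin; zero; suc; toℕ; fromℕ<; finToFun; funToFin; join; splitAt)
import Data.Fin.Properties as Fin
open import Data.List.Base
  using (List; []; _∷_; _++_; _ʳ++_; length; map; concatMap; applyUpTo; lookup; filter; allFin;
         replicate; reverse; take; drop)
import Data.List.Properties as List
open import Data.List.Membership.Propositional using (_∈_; find; lose)
open import Data.List.Membership.Propositional.Properties
  using (∈-++⁺ˡ; ∈-++⁺ʳ; ∈-++⁻; ∈-map⁺; ∈-map⁻; ∈-concatMap⁺; ∈-concatMap⁻; ∈-applyUpTo⁺;
         ∈-applyUpTo⁻; ∈-lookup; ∈-filter⁺; ∈-filter⁻; ∈-allFin)
open import Data.List.Relation.Unary.All as All using (All; []; _∷_)
import Data.List.Relation.Unary.All.Properties as All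
open import Data.List.Relation.Unary.AllPairs using (_∷_; [])
open import Data.List.Relation.Unary.Any as ListAny using (here; there)
import Data.List.Relation.Unary.Any.Properties as ListAny
open import Data.List.Relation.Unary.Unique.Propositional using (Unique)
import Data.List.Relation.Unary.Unique.Propositional.Properties as Unique
open import Data.Nat.Base as ℕ using (ℕ; zero; suc; _≤_; _<_; z≤n; s≤s; _^_; _≡ᵇ_; _∸_; _⊔_)
import Data.Nat.Properties as ℕ
open import Data.Nat.Logarithm using (⌊log₂_⌋; ⌊log₂⌋-mono-≤; ⌊log₂[2^n]⌋≡n)
open import Data.Parity.Base using (0ℙ; 1ℙ) renaming (_+_ to infixl 6 _+_; _*_ to infixl 7 _*_)
open import Data.Parity.Properties using (+-*-commutativeRing)
open import Data.Product.Base using (∃; ∃-syntax; ∃₂; _×_; _,_; proj₁; proj₂)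
open import Data.Sum.Base using (_⊎_; inj₁; inj₂)
open import Data.Sum.Properties using (inj₁-injective; inj₂-injective)
open import Data.Unit.Base using (⊤; tt)
open import Data.Vec.Base as Vec using (Vec; []; _∷_)
import Data.Vec.Properties as Vec
open import Data.Vec.Functional using (Vector)
import Data.Vec.Relation.Unary.All as VecAll
import Data.Vec.Relation.Unary.All.Properties as VecAll
import Data.Vec.Relation.Unary.Any as VecAny
open import Function.Base using (_∘_)
open import Relation.Binary.PropositionalEquality
  using (_≡_; _≢_; _≗_; refl; sym; trans; cong; cong₂; subst; subst₂; module ≡-Reasoning)
open import Relation.Nullary.Decidable using (dec-true; dec-false)
open import Relation.Nullary.Decidable.Core using (yes; no)
open import Relation.Nullary.Negation.Core using (¬_; contradiction)

open CommutativeRing +-*-commutativeRing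
  using (*-comm; +-identityʳ; *-identityʳ; zeroʳ; distribˡ; distribʳ; +-assoc; *-assoc)
open import Algebra.Properties.Semiring.Sum (CommutativeRing.semiring +-*-commutativeRing)
  using (sum-cong-≗; sum-replicate-zero; ∑-distrib-+; *-distribˡ-sum; *-distribʳ-sum)

-- Linear algebra

-- Coefficients form a `Vec` rather than a function, so that injectivity can be stated with
-- propositional equality, without function extensionality.
combine-vec : ∀ {R} {C : Set} → (C → F₂) → Vec F₂ R → Vec C R → F₂
combine-vec f [] [] = 0ℙ
combine-vec f (a ∷ α) (c ∷ cs) = a * f c + combine-vec f α cs

F₂→Fin : F₂ → Fin 2
F₂→Fin 0ℙ = zero
F₂→Fin 1ℙ = suc zero

Fin→F₂ : Fin 2 → F₂
Fin→F₂ zero    = 0ℙ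
Fin→F₂ (suc _) = 1ℙ

F₂→Fin→F₂ : ∀ a → Fin→F₂ (F₂→Fin a) ≡ a
F₂→Fin→F₂ 0ℙ = refl
F₂→Fin→F₂ 1ℙ = refl

Fin→F₂→Fin : ∀ i → F₂→Fin (Fin→F₂ i) ≡ i
Fin→F₂→Fin zero       = refl
Fin→F₂→Fin (suc zero) = refl

funToFin-cong : ∀ {m n} {f g : Fin m → Fin n} → f ≗ g → funToFin f ≡ funToFin g
funToFin-cong {zero}  _   = refl
funToFin-cong {suc m} {n} f≗g
  rewrite f≗g zero | funToFin-cong {m} {n} (f≗g ∘ suc) = refl

-- Over the two-element field dimensions can be compared by counting: `f` induces an injection of
-- `Fin (2 ^ R)` into `Fin (2 ^ r)`. This takes the place of Gaussian elimination.
F₂^-injective⇒≤ : ∀ {R r} (f : Vec F₂ R → Fin r → F₂) →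
  (∀ α β → f α ≗ f β → α ≡ β) → R ≤ r
F₂^-injective⇒≤ {R} {r} f inj = ℕ.≮⇒≥ λ r<R →
  ℕ.<⇒≱ (ℕ.^-monoʳ-< 2 (s≤s (s≤s z≤n)) r<R) (Fin.injective⇒≤ {f = g} g-injective)
  where
  vec : Fin (2 ^ R) → Vec F₂ R
  vec i = Vec.tabulate (Fin→F₂ ∘ finToFun i)

  vec-injective : ∀ i j → vec i ≡ vec j → i ≡ j
  vec-injective i j eq = begin
    i                      ≡⟨ Fin.funToFin-finToFin {R} i ⟨
    funToFin {R} (finToFun i) ≡⟨ funToFin-cong same ⟩
    funToFin {R} (finToFun j) ≡⟨ Fin.funToFin-finToFin {R} j ⟩
    j                      ∎
    where
    open ≡-Reasoning
    same : finToFun {2} {R} i ≗ finToFun j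
    same x = begin
      finToFun i x                              ≡⟨ Fin→F₂→Fin _ ⟨
      F₂→Fin (Fin→F₂ (finToFun i x))            ≡⟨ cong F₂→Fin (Vec.lookup∘tabulate (Fin→F₂ ∘ finToFun i) x) ⟨
      F₂→Fin (Vec.lookup (vec i) x)             ≡⟨ cong (λ v → F₂→Fin (Vec.lookup v x)) eq ⟩
      F₂→Fin (Vec.lookup (vec j) x)             ≡⟨ cong F₂→Fin (Vec.lookup∘tabulate (Fin→F₂ ∘ finToFun j) x) ⟩
      F₂→Fin (Fin→F₂ (finToFun j x))            ≡⟨ Fin→F₂→Fin _ ⟩
      finToFun j x                              ∎

  g : Fin (2 ^ R) → Fin (2 ^ r)
  g i = funToFin (F₂→Fin ∘ f (vec i))

  g-injective : ∀ {i j} → g i ≡ g j → i ≡ j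
  g-injective {i} {j} eq = vec-injective i j (inj _ _ λ l → begin
    f (vec i) l                            ≡⟨ F₂→Fin→F₂ _ ⟨
    Fin→F₂ (F₂→Fin (f (vec i) l))          ≡⟨ cong Fin→F₂ (Fin.finToFun-funToFin (F₂→Fin ∘ f (vec i)) l) ⟨
    Fin→F₂ (finToFun (g i) l)              ≡⟨ cong (λ x → Fin→F₂ (finToFun x l)) eq ⟩
    Fin→F₂ (finToFun (g j) l)              ≡⟨ cong Fin→F₂ (Fin.finToFun-funToFin (F₂→Fin ∘ f (vec j)) l) ⟩
    Fin→F₂ (F₂→Fin (f (vec j) l))          ≡⟨ F₂→Fin→F₂ _ ⟩
    f (vec j) l                            ∎)
    where open ≡-Reasoning

-- The columns cs of M, restricted to the rows in P, are independent.  The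
-- formulation as injectivity avoids subtraction.

Independent : ∀ {X C : Set} {R} → (X → Set) → (X → C → F₂) → Vec C R → Set
Independent P M cs = ∀ α β →
  (∀ x → P x → combine-vec (M x) α cs ≡ combine-vec (M x) β cs) → α ≡ β

interchange : ∀ a b c d → (a + b) + (c + d) ≡ (a + c) + (b + d)
interchange 0ℙ 0ℙ c d = refl
interchange 0ℙ 1ℙ 0ℙ d = refl
interchange 0ℙ 1ℙ 1ℙ 0ℙ = refl
interchange 0ℙ 1ℙ 1ℙ 1ℙ = refl
interchange 1ℙ 0ℙ 0ℙ d = refl
interchange 1ℙ 0ℙ 1ℙ 0ℙ = refl
interchange 1ℙ 0ℙ 1ℙ 1ℙ = refl
interchange 1ℙ 1ℙ 0ℙ 0ℙ = refl
interchange 1ℙ 1ℙ 0ℙ 1ℙ = refl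
interchange 1ℙ 1ℙ 1ℙ 0ℙ = refl
interchange 1ℙ 1ℙ 1ℙ 1ℙ = refl

combine-vec-cong : ∀ {R} {C : Set} {f g : C → F₂} → f ≗ g → ∀ (α : Vec F₂ R) cs →
  combine-vec f α cs ≡ combine-vec g α cs
combine-vec-cong f≗g [] [] = refl
combine-vec-cong f≗g (a ∷ α) (c ∷ cs) =
  cong₂ (λ x y → a * x + y) (f≗g c) (combine-vec-cong f≗g α cs)

combine-vec-combination : ∀ {R r} {C : Set} (x : Vector F₂ r) (f : C → Vector F₂ r)
  (α : Vec F₂ R) cs →
  combine-vec (λ c → sum₂ (λ l → f c l * x l)) α cs ≡
  sum₂ (λ l → combine-vec (λ c → f c l) α cs * x l)
combine-vec-combination {r = r} x f [] [] = sym (sum-replicate-zero r)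
combine-vec-combination {r = r} x f (a ∷ α) (c ∷ cs) = begin
  a * sum₂ (λ l → f c l * x l) + combine-vec (λ c → sum₂ (λ l → f c l * x l)) α cs
    ≡⟨ cong₂ _+_ (*-distribˡ-sum a (λ l → f c l * x l)) (combine-vec-combination x f α cs) ⟩
  sum₂ (λ l → a * (f c l * x l)) + sum₂ (λ l → combine-vec (λ c → f c l) α cs * x l)
    ≡⟨ ∑-distrib-+ (λ l → a * (f c l * x l)) (λ l → combine-vec (λ c → f c l) α cs * x l) ⟨
  sum₂ (λ l → a * (f c l * x l) + combine-vec (λ c → f c l) α cs * x l)
    ≡⟨ sum-cong-≗ (λ l → cong (_+ (combine-vec (λ c → f c l) α cs * x l)) (sym (*-assoc a (f c l) (x l)))) ⟩
  sum₂ (λ l → a * f c l * x l + combine-vec (λ c → f c l) α cs * x l)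
    ≡⟨ sum-cong-≗ (λ l → distribʳ (x l) (a * f c l) (combine-vec (λ c → f c l) α cs)) ⟨
  sum₂ (λ l → (a * f c l + combine-vec (λ c → f c l) α cs) * x l) ∎
  where open ≡-Reasoning

-- The coordinates with respect to `b` of a combination of the columns `cs` determine its value in
-- every row, hence, by independence, its coefficients. So coefficients map injectively to
-- coordinates.
independent⇒≤ : ∀ {I C : Set} {R r} (M : I → C → F₂) (b : Vector (Space I) r) →
  (∀ c → Span b (λ i → M i c)) →
  {P : I → Set} (cs : Vec C R) → Independent P M cs → R ≤ r
independent⇒≤ M b spanned cs indep = F₂^-injective⇒≤
  (λ α l → combine-vec (λ c → proj₁ (spanned c) l) α cs)
  λ α β eq → indep α β λ i _ → trans (expand i α)
    (trans (sum-cong-≗ (λ l → cong (_* b l i) (eq l))) (sym (expand i β)))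
  where
  expand : ∀ i α → combine-vec (M i) α cs ≡
    sum₂ (λ l → combine-vec (λ c → proj₁ (spanned c) l) α cs * b l i)
  expand i α = trans (combine-vec-cong (λ c → proj₂ (spanned c) i) α cs)
    (combine-vec-combination (λ l → b l i) (λ c → proj₁ (spanned c)) α cs)

δ : ∀ {m} → Fin m → Vector F₂ m
δ zero    zero    = 1ℙ
δ zero    (suc _) = 0ℙ
δ (suc _) zero    = 0ℙ
δ (suc i) (suc j) = δ i j

sum-δ : ∀ {m} (j : Fin m) (f : Vector F₂ m) → sum₂ (λ l → δ j l * f l) ≡ f j
sum-δ {suc m} zero    f = trans (cong (f zero +_) (sum-replicate-zero m)) (+-identityʳ (f zero))
sum-δ (suc j) f = sum-δ j (f ∘ suc)

∈-Span : ∀ {I m} (v : Vector (Space I) m) j → Span v (v j)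
∈-Span v j = δ j , λ i → sym (sum-δ j (λ l → v l i))

Span-𝟎 : ∀ {I m} (v : Vector (Space I) m) → Span v 𝟎
Span-𝟎 {m = m} v = (λ _ → 0ℙ) , λ i → sym (sum-replicate-zero m)

Span-+ : ∀ {I m} (v : Vector (Space I) m) {x y : Space I} →
  Span v x → Span v y → Span v (λ i → x i + y i)
Span-+ v {x} {y} (a , x≗) (b , y≗) = (λ j → a j + b j) , λ i → begin
  x i + y i                                          ≡⟨ cong₂ _+_ (x≗ i) (y≗ i) ⟩
  sum₂ (λ j → a j * v j i) + sum₂ (λ j → b j * v j i)  ≡⟨ ∑-distrib-+ (λ j → a j * v j i) (λ j → b j * v j i) ⟨
  sum₂ (λ j → a j * v j i + b j * v j i)              ≡⟨ sum-cong-≗ (λ j → distribʳ (v j i) (a j) (b j)) ⟨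
  sum₂ (λ j → (a j + b j) * v j i)                    ∎
  where open ≡-Reasoning

Span-resp : ∀ {I m} {v : Vector (Space I) m} {x y : Space I} → x ≗ y → Span v x → Span v y
Span-resp x≗y (a , x≗) = a , λ i → trans (sym (x≗y i)) (x≗ i)

RankAtMost⇒≤ : ∀ {N k R} (M : Matrix N) {P : Fin N → Set} (js : Vec (Fin N) R) →
  RankAtMost M k → Independent P (λ i j → M (i , j)) js → R ≤ k
RankAtMost⇒≤ M js (r , r≤k , b , _ , _ , spanned) indep = ℕ.≤-trans
  (independent⇒≤ (λ i j → M (i , j)) b (λ j → spanned _ (∈-Span (columns M) j)) js indep) r≤k

-- The basis is `ε` itself, which is the column `i₀` of `M` because its entry there is 1.
rank-one : ∀ {N} (ε : Space (Fin N)) i₀ → ε i₀ ≡ 1ℙ →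
  (M : Matrix N) → (∀ i j → M (i , j) ≡ ε i * ε j) → HasRank M 1
rank-one ε i₀ ε₁ M M≗ = (λ _ → ε) , (λ _ → spans) , independent , spanned
  where
  spans : Span (columns M) ε
  spans = Span-resp (λ i → trans (M≗ i i₀) (trans (cong (ε i *_) ε₁) (*-identityʳ (ε i))))
    (∈-Span (columns M) i₀)

  independent : LinearlyIndependent (λ (_ : Fin 1) → ε)
  independent a a≗0 zero = begin
    a zero                 ≡⟨ *-identityʳ (a zero) ⟨
    a zero * 1ℙ            ≡⟨ cong (a zero *_) ε₁ ⟨
    a zero * ε i₀          ≡⟨ +-identityʳ _ ⟨
    a zero * ε i₀ + 0ℙ     ≡⟨ a≗0 i₀ ⟩
    0ℙ                     ∎
    where open ≡-Reasoning

  spanned : ∀ w → Span (columns M) w → Span (λ (_ : Fin 1) → ε) w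
  spanned w (a , w≗) = (λ _ → sum₂ (λ j → a j * ε j)) , λ i → begin
    w i                                 ≡⟨ w≗ i ⟩
    sum₂ (λ j → a j * M (i , j))        ≡⟨ sum-cong-≗ (λ j → trans
                                             (cong (a j *_) (trans (M≗ i j) (*-comm (ε i) (ε j))))
                                             (sym (*-assoc (a j) (ε j) (ε i)))) ⟩
    sum₂ (λ j → a j * ε j * ε i)        ≡⟨ *-distribʳ-sum (ε i) (λ j → a j * ε j) ⟨
    sum₂ (λ j → a j * ε j) * ε i        ≡⟨ +-identityʳ _ ⟨
    sum₂ (λ j → a j * ε j) * ε i + 0ℙ   ∎
    where open ≡-Reasoning

-- Words and functionals

Word : ℕ → Set
Word n = List (Literal n)

fromBool : Bool → F₂
fromBool false = 0ℙ
fromBool true  = 1ℙ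

-- A word stands for the product of the negations of its literals, so that
-- a clause, read as a word, is the indicator of falsifying it.

factor : ∀ {n} → Assignment n → Literal n → F₂
factor α l = fromBool (not (evalLiteral α l))

ev : ∀ {n} → Assignment n → Word n → F₂
ev α []      = 1ℙ
ev α (l ∷ V) = factor α l * ev α V

ev-++ : ∀ {n} (α : Assignment n) U V → ev α (U ++ V) ≡ ev α U * ev α V
ev-++ α []      V = refl
ev-++ α (l ∷ U) V = trans (cong (factor α l *_) (ev-++ α U V))
  (sym (*-assoc (factor α l) (ev α U) (ev α V)))

flip : ∀ {n} → Literal n → Literal n
flip (pos x) = neg x
flip (neg x) = pos x

factor-flip : ∀ {n} (α : Assignment n) l → factor α l + factor α (flip l) ≡ 1ℙ
factor-flip α (pos x) with α x
... | true  = refl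
... | false = refl
factor-flip α (neg x) with α x
... | true  = refl
... | false = refl

factor-contra : ∀ {n} (α : Assignment n) l → factor α (flip l) * factor α l ≡ 0ℙ
factor-contra α (pos x) with α x
... | true  = refl
... | false = refl
factor-contra α (neg x) with α x
... | true  = refl
... | false = refl

-- ℓ behaves like the restriction to words of a linear functional on the
-- functions {0,1}ⁿ → F₂.

record Functional {n} (ℓ : Word n → F₂) : Set where
  field
    ℓ-cong  : ∀ U V → (∀ α → ev α U ≡ ev α V) → ℓ U ≡ ℓ V
    ℓ-zero  : ∀ U → (∀ α → ev α U ≡ 0ℙ) → ℓ U ≡ 0ℙ
    ℓ-split : ∀ l V → ℓ (l ∷ V) + ℓ (flip l ∷ V) ≡ ℓ V

ev-swap : ∀ {n} (α : Assignment n) x y V → ev α (x ∷ y ∷ V) ≡ ev α (y ∷ x ∷ V)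
ev-swap α x y V = begin
  factor α x * (factor α y * ev α V) ≡⟨ *-assoc (factor α x) _ _ ⟨
  factor α x * factor α y * ev α V   ≡⟨ cong (_* ev α V) (*-comm (factor α x) (factor α y)) ⟩
  factor α y * factor α x * ev α V   ≡⟨ *-assoc (factor α y) _ _ ⟩
  factor α y * (factor α x * ev α V) ∎
  where open ≡-Reasoning

ev-shift : ∀ {n} (α : Assignment n) U x V → ev α (U ++ x ∷ V) ≡ ev α (x ∷ U ++ V)
ev-shift α []      x V = refl
ev-shift α (y ∷ U) x V = trans (cong (factor α y *_) (ev-shift α U x V)) (ev-swap α y x (U ++ V))

ev-contra : ∀ {n} (α : Assignment n) l U V → ev α ((flip l ∷ U) ++ l ∷ V) ≡ 0ℙ
ev-contra α l U V = begin
  factor α (flip l) * ev α (U ++ l ∷ V)         ≡⟨ cong (factor α (flip l) *_) (ev-shift α U l V) ⟩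
  factor α (flip l) * (factor α l * ev α (U ++ V)) ≡⟨ *-assoc (factor α (flip l)) _ _ ⟨
  factor α (flip l) * factor α l * ev α (U ++ V)   ≡⟨ cong (_* ev α (U ++ V)) (factor-contra α l) ⟩
  0ℙ                                            ∎
  where open ≡-Reasoning

shift : ∀ {n} {ℓ : Word n → F₂} x → Functional ℓ → Functional (ℓ ∘ (x ∷_))
shift {ℓ = ℓ} x F = record
  { ℓ-cong  = λ U V eq → ℓ-cong (x ∷ U) (x ∷ V) λ α → cong (factor α x *_) (eq α)
  ; ℓ-zero  = λ U eq → ℓ-zero (x ∷ U) λ α → trans (cong (factor α x *_) (eq α)) (zeroʳ (factor α x))
  -- Splitting acts on the first letter only, so `x` is first moved behind the literal to be split.
  ; ℓ-split = λ l V → trans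
      (cong₂ _+_ (ℓ-cong (x ∷ l ∷ V) (l ∷ x ∷ V) λ α → ev-swap α x l V)
                 (ℓ-cong (x ∷ flip l ∷ V) (flip l ∷ x ∷ V) λ α → ev-swap α x (flip l) V))
      (ℓ-split l (x ∷ V))
  }
  where open Functional F

-- Branching literals of a functional

sum-1-0 : ∀ {a b} → a + b ≡ 1ℙ → a ≡ 0ℙ → b ≡ 1ℙ
sum-1-0 eq refl = eq

sum-0-1 : ∀ {a b} → a + b ≡ 0ℙ → a ≡ 1ℙ → b ≡ 1ℙ
sum-0-1 {b = 1ℙ} eq refl = refl

Branching : ∀ {n} → (Word n → F₂) → ℕ → Set
Branching ℓ d = ∃[ x ]
  (∃[ u ] length u < d × ℓ (x ∷ u) ≡ 1ℙ) × (∃[ u ] length u < d × ℓ (flip x ∷ u) ≡ 1ℙ)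

Branching-mono : ∀ {n} {ℓ : Word n → F₂} {d e} → d ≤ e → Branching ℓ d → Branching ℓ e
Branching-mono d≤e (x , (u , u< , ℓu) , (v , v< , ℓv)) =
  x , (u , ℕ.<-≤-trans u< d≤e , ℓu) , (v , ℕ.<-≤-trans v< d≤e , ℓv)

zero-or-one : ∀ a → a ≡ 0ℙ ⊎ a ≡ 1ℙ
zero-or-one 0ℙ = inj₁ refl
zero-or-one 1ℙ = inj₂ refl

module _ {n : ℕ} {ℓ : Word n → F₂} (F : Functional ℓ) where
  open Functional F

  -- Letters are removed from the front while the value stays 1. At the first drop to 0 the removed
  -- letter branches, with the remaining word as witness on both sides; without a drop the empty
  -- word is reached.
  branch-or-constant : ∀ w → ℓ w ≡ 1ℙ → Branching ℓ (length w) ⊎ ℓ [] ≡ 1ℙ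
  branch-or-constant []      ℓw = inj₂ ℓw
  branch-or-constant (x ∷ w) ℓw with zero-or-one (ℓ w)
  ... | inj₁ ℓ0 = inj₁ (x , (w , ℕ.≤-refl , ℓw) , (w , ℕ.≤-refl , sum-0-1 (trans (ℓ-split x w) ℓ0) ℓw))
  ... | inj₂ ℓ1 with branch-or-constant w ℓ1
  ...   | inj₁ (y , (u , u< , ℓu) , (v , v< , ℓv)) =
    inj₁ (y , (u , ℕ.m<n⇒m<1+n u< , ℓu) , (v , ℕ.m<n⇒m<1+n v< , ℓv))
  ...   | inj₂ ℓ[] = inj₂ ℓ[]

  -- If ℓ [] ≡ 1ℙ, the first moments of ℓ are those of one assignment.

  rounding : Assignment n
  rounding x with ℓ (pos x ∷ [])
  ... | 0ℙ = true
  ... | 1ℙ = false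

  -- A letter stands for the negation of its literal, hence a literal made false has first moment 1.
  -- For `neg x` this is the complement, within `ℓ [] ≡ 1ℙ`, of the moment of `pos x`.
  rounding-false : ℓ [] ≡ 1ℙ → ∀ l → evalLiteral rounding l ≡ false → ℓ (l ∷ []) ≡ 1ℙ
  rounding-false ℓ[] (pos x) eq with ℓ (pos x ∷ [])
  ... | 1ℙ = refl
  rounding-false ℓ[] (neg x) eq with ℓ (pos x ∷ []) in eqx
  ... | 0ℙ = sum-1-0 (trans (ℓ-split (pos x) []) ℓ[]) eqx

  -- Along the prefixes `l₁`, `l₁ l₂`, `l₁ l₂ l₃` the value falls from 1 to 0. The letter at which
  -- it falls branches: alone it has value 1, and its flip has value 1 on the preceding prefix.
  falsified-branch : ℓ [] ≡ 1ℙ → ∀ l₁ l₂ l₃ → (∀ l → l ∈ l₁ ∷ l₂ ∷ l₃ ∷ [] → ℓ (l ∷ []) ≡ 1ℙ) →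
    ℓ (l₁ ∷ l₂ ∷ l₃ ∷ []) ≡ 0ℙ → Branching ℓ 3
  falsified-branch ℓ[] l₁ l₂ l₃ ones ℓC with zero-or-one (ℓ (l₁ ∷ l₂ ∷ []))
  ... | inj₁ ℓ0 = l₂ , ([] , s≤s z≤n , ones l₂ (there (here refl))) ,
      (l₁ ∷ [] , s≤s (s≤s z≤n) ,
       sum-1-0 (trans (ℓ-split l₂ (l₁ ∷ [])) (ones l₁ (here refl)))
         (trans (ℓ-cong (l₂ ∷ l₁ ∷ []) (l₁ ∷ l₂ ∷ []) λ α → ev-swap α l₂ l₁ []) ℓ0))
  ... | inj₂ ℓ1 = l₃ , ([] , s≤s z≤n , ones l₃ (there (there (here refl)))) ,
      (l₁ ∷ l₂ ∷ [] , s≤s (s≤s (s≤s z≤n)) ,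
       sum-1-0 (trans (ℓ-split l₃ (l₁ ∷ l₂ ∷ [])) ℓ1)
         (trans (ℓ-cong (l₃ ∷ l₁ ∷ l₂ ∷ []) (l₁ ∷ l₂ ∷ l₃ ∷ [])
            λ α → sym (ev-shift α (l₁ ∷ l₂ ∷ []) l₃ [])) ℓC))

Annihilates : ∀ {n} → 3CNF n → ℕ → (Word n → F₂) → Set
Annihilates φ d ℓ = ∀ C → C ∈ 3CNF.clauses φ → ∀ q → length q ≤ d → ℓ (Vec.toList C ++ q) ≡ 0ℙ

none-true : ∀ {n m} {α : Assignment n} (C : Vec (Literal n) m) →
  ¬ VecAny.Any (λ l → evalLiteral α l ≡ true) C → VecAll.All (λ l → evalLiteral α l ≡ false) C
none-true []      ¬any = VecAll.[]
none-true (l ∷ C) ¬any = Bool.¬-not (¬any ∘ VecAny.here) VecAll.∷ none-true C (¬any ∘ VecAny.there)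

-- Satisfaction by a fixed assignment is decidable, so the clause is found constructively.
falsified-clause : ∀ {n} (φ : 3CNF n) → ¬ Satisfiable φ → ∀ α →
  ∃[ C ] C ∈ 3CNF.clauses φ × VecAll.All (λ l → evalLiteral α l ≡ false) C
falsified-clause φ unsat α with All.all? (VecAny.any? (λ l → evalLiteral α l Bool.≟ true)) (3CNF.clauses φ)
... | yes sat   = contradiction (α , sat) unsat
... | no ¬sat with find (All.¬All⇒Any¬ (VecAny.any? (λ l → evalLiteral α l Bool.≟ true)) _ ¬sat)
...   | C , C∈ , ¬any = C , C∈ , none-true C ¬any

-- The word `w` may be short, but a falsified clause needs witnesses of up to two letters; hence the
-- maximum with 3.
branching : ∀ {n} (φ : 3CNF n) → ¬ Satisfiable φ → {ℓ : Word n → F₂} → Functional ℓ →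
  Annihilates φ 0 ℓ → ∀ w → ℓ w ≡ 1ℙ → Branching ℓ (length w ℕ.⊔ 3)
branching φ unsat {ℓ} F ann w ℓw with branch-or-constant F w ℓw
... | inj₁ b = Branching-mono {ℓ = ℓ} (ℕ.m≤m⊔n (length w) 3) b
... | inj₂ ℓ[] with falsified-clause φ unsat (rounding F)
...   | l₁ ∷ l₂ ∷ l₃ ∷ [] , C∈ , f₁ VecAll.∷ f₂ VecAll.∷ f₃ VecAll.∷ VecAll.[] =
  Branching-mono {ℓ = ℓ} (ℕ.m≤n⊔m (length w) 3)
    (falsified-branch F ℓ[] l₁ l₂ l₃
      (λ l l∈ → rounding-false F ℓ[] l
        (All.lookup {P = λ l → evalLiteral (rounding F) l ≡ false} (f₁ ∷ f₂ ∷ f₃ ∷ []) l∈))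
      (ann _ C∈ [] z≤n))

-- Rank growth of moment matrices under branching

combine-vec-++ : ∀ {R S} {C : Set} (f : C → F₂) (α : Vec F₂ R) (β : Vec F₂ S) cs ds →
  combine-vec f (α Vec.++ β) (cs Vec.++ ds) ≡ combine-vec f α cs + combine-vec f β ds
combine-vec-++ f []      β []       ds = refl
combine-vec-++ f (a ∷ α) β (c ∷ cs) ds = trans (cong (a * f c +_) (combine-vec-++ f α β cs ds))
  (sym (+-assoc (a * f c) (combine-vec f α cs) (combine-vec f β ds)))

combine-vec-map : ∀ {R} {C D : Set} (f : D → F₂) (g : C → D) (α : Vec F₂ R) cs →
  combine-vec f α (Vec.map g cs) ≡ combine-vec (f ∘ g) α cs
combine-vec-map f g []      []       = refl
combine-vec-map f g (a ∷ α) (c ∷ cs) = cong (a * f (g c) +_) (combine-vec-map f g α cs)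

combine-vec-zero : ∀ {R} {C : Set} {f : C → F₂} → (∀ c → f c ≡ 0ℙ) → ∀ (α : Vec F₂ R) cs →
  combine-vec f α cs ≡ 0ℙ
combine-vec-zero f≗0 []      []       = refl
combine-vec-zero f≗0 (a ∷ α) (c ∷ cs) =
  cong₂ _+_ (trans (cong (a *_) (f≗0 c)) (zeroʳ a)) (combine-vec-zero f≗0 α cs)

F₂-cancelʳ : ∀ {a b} c → a + c ≡ b + c → a ≡ b
F₂-cancelʳ {0ℙ} {0ℙ} c  eq = refl
F₂-cancelʳ {1ℙ} {1ℙ} c  eq = refl
F₂-cancelʳ {0ℙ} {1ℙ} 0ℙ ()
F₂-cancelʳ {0ℙ} {1ℙ} 1ℙ ()
F₂-cancelʳ {1ℙ} {0ℙ} 0ℙ ()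
F₂-cancelʳ {1ℙ} {0ℙ} 1ℙ ()

-- The moment matrix of ℓ with rows of degree at most a and columns of
-- degree at most b has rank at least R.

Wide : ∀ {n} → ℕ → (a b : ℕ) → (Word n → F₂) → Set
Wide {n} R a b ℓ = ∃ λ (cs : Vec (Word n) R) →
  VecAll.All (λ c → length c ≤ b) cs × Independent (λ p → length p ≤ a) (λ p c → ℓ (p ++ c)) cs

-- The block matrix with rows ¬x·p and p, and columns x·c and d, is
-- triangular, since ¬x·x = 0.  Only one degree is lost on either side.

Wide-+ : ∀ {n R S a b} {ℓ : Word n → F₂} → Functional ℓ → ∀ x →
  Wide R (suc a) b (ℓ ∘ (x ∷_)) → Wide S a (suc b) (ℓ ∘ (flip x ∷_)) → Wide (R ℕ.+ S) (suc a) (suc b) ℓ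
Wide-+ {R = R} {S} {a} {b} {ℓ} F x (cs , cs≤ , cs-indep) (ds , ds≤ , ds-indep) =
  Vec.map (x ∷_) cs Vec.++ ds ,
  VecAll.++⁺ (VecAll.map⁺ (VecAll.map s≤s cs≤)) ds≤ ,
  indep
  where
  open Functional F

  expand : ∀ p (α : Vec F₂ R) (β : Vec F₂ S) →
    combine-vec (λ c → ℓ (p ++ c)) (α Vec.++ β) (Vec.map (x ∷_) cs Vec.++ ds) ≡
    combine-vec (λ c → ℓ (p ++ x ∷ c)) α cs + combine-vec (λ c → ℓ (p ++ c)) β ds
  expand p α β = trans (combine-vec-++ (λ c → ℓ (p ++ c)) α β (Vec.map (x ∷_) cs) ds)
    (cong (_+ combine-vec (λ c → ℓ (p ++ c)) β ds) (combine-vec-map (λ c → ℓ (p ++ c)) (x ∷_) α cs))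

  expand-flip : ∀ p α β →
    combine-vec (λ c → ℓ ((flip x ∷ p) ++ c)) (α Vec.++ β) (Vec.map (x ∷_) cs Vec.++ ds) ≡
    combine-vec (λ c → ℓ (flip x ∷ p ++ c)) β ds
  expand-flip p α β = trans (expand (flip x ∷ p) α β)
    (cong (_+ combine-vec (λ c → ℓ (flip x ∷ p ++ c)) β ds)
      (combine-vec-zero (λ c → ℓ-zero (flip x ∷ p ++ x ∷ c) λ α → ev-contra α x p c) α cs))

  indep : Independent (λ p → length p ≤ suc a) (λ p c → ℓ (p ++ c)) (Vec.map (x ∷_) cs Vec.++ ds)
  indep γ γ′ eq with Vec.splitAt R γ | Vec.splitAt R γ′
  ... | α , β , refl | α′ , β′ , refl = cong₂ Vec._++_ α≡α′ β≡β′
    where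
    β≡β′ : β ≡ β′
    β≡β′ = ds-indep β β′ λ p p≤ → trans (sym (expand-flip p α β))
      (trans (eq (flip x ∷ p) (s≤s p≤)) (expand-flip p α′ β′))

    α≡α′ : α ≡ α′
    α≡α′ = cs-indep α α′ λ p p≤ → begin
      combine-vec (λ c → ℓ (x ∷ p ++ c)) α cs
        ≡⟨ combine-vec-cong (λ c → ℓ-cong (p ++ x ∷ c) (x ∷ p ++ c) λ α → ev-shift α p x c) α cs ⟨
      combine-vec (λ c → ℓ (p ++ x ∷ c)) α cs
        ≡⟨ F₂-cancelʳ (combine-vec (λ c → ℓ (p ++ c)) β ds) (begin
             combine-vec (λ c → ℓ (p ++ x ∷ c)) α cs + combine-vec (λ c → ℓ (p ++ c)) β ds
               ≡⟨ expand p α β ⟨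
             combine-vec (λ c → ℓ (p ++ c)) (α Vec.++ β) (Vec.map (x ∷_) cs Vec.++ ds)
               ≡⟨ eq p p≤ ⟩
             combine-vec (λ c → ℓ (p ++ c)) (α′ Vec.++ β′) (Vec.map (x ∷_) cs Vec.++ ds)
               ≡⟨ expand p α′ β′ ⟩
             combine-vec (λ c → ℓ (p ++ x ∷ c)) α′ cs + combine-vec (λ c → ℓ (p ++ c)) β′ ds
               ≡⟨ cong (λ β → combine-vec (λ c → ℓ (p ++ x ∷ c)) α′ cs + combine-vec (λ c → ℓ (p ++ c)) β ds) β≡β′ ⟨
             combine-vec (λ c → ℓ (p ++ x ∷ c)) α′ cs + combine-vec (λ c → ℓ (p ++ c)) β ds ∎) ⟩
      combine-vec (λ c → ℓ (p ++ x ∷ c)) α′ cs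
        ≡⟨ combine-vec-cong (λ c → ℓ-cong (p ++ x ∷ c) (x ∷ p ++ c) λ α → ev-shift α p x c) α′ cs ⟩
      combine-vec (λ c → ℓ (x ∷ p ++ c)) α′ cs ∎
      where open ≡-Reasoning

-- The letter `x` is absorbed by the multiplier `q` of the clause, so each branching costs one
-- degree of annihilation.
Annihilates-shift : ∀ {n d} (φ : 3CNF n) {ℓ : Word n → F₂} → Functional ℓ → ∀ x →
  Annihilates φ (suc d) ℓ → Annihilates φ d (ℓ ∘ (x ∷_))
Annihilates-shift φ F x ann C C∈ q q≤ = trans
  (ℓ-cong (x ∷ Vec.toList C ++ q) (Vec.toList C ++ x ∷ q) λ α → sym (ev-shift α (Vec.toList C) x q))
  (ann C C∈ (x ∷ q) (s≤s q≤))
  where open Functional F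

Annihilates-mono : ∀ {n d e} (φ : 3CNF n) {ℓ : Word n → F₂} → d ≤ e → Annihilates φ e ℓ → Annihilates φ d ℓ
Annihilates-mono φ d≤e ann C C∈ q q≤ = ann C C∈ q (ℕ.≤-trans q≤ d≤e)

Wide-1 : ∀ {n} (ℓ : Word n → F₂) u v → ℓ (u ++ v) ≡ 1ℙ → Wide 1 (length u) (length v) ℓ
Wide-1 ℓ u v ℓ1 = v ∷ [] , (ℕ.≤-refl VecAll.∷ VecAll.[]) , indep
  where
  open ≡-Reasoning
  simplify : ∀ a → a * ℓ (u ++ v) + 0ℙ ≡ a
  simplify a = trans (+-identityʳ _) (trans (cong (a *_) ℓ1) (*-identityʳ a))

  indep : Independent (λ p → length p ≤ length u) (λ p c → ℓ (p ++ c)) (v ∷ [])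
  indep (a ∷ []) (b ∷ []) eq = cong (_∷ []) (begin
    a                        ≡⟨ simplify a ⟨
    a * ℓ (u ++ v) + 0ℙ      ≡⟨ eq u ℕ.≤-refl ⟩
    b * ℓ (u ++ v) + 0ℙ      ≡⟨ simplify b ⟩
    b                        ∎)

Wide-mono : ∀ {n R a b a′ b′} {ℓ : Word n → F₂} → a ≤ a′ → b ≤ b′ → Wide R a b ℓ → Wide R a′ b′ ℓ
Wide-mono a≤ b≤ (cs , cs≤ , indep) = cs , VecAll.map (λ c≤ → ℕ.≤-trans c≤ b≤) cs≤ ,
  λ α β eq → indep α β λ p p≤ → eq p (ℕ.≤-trans p≤ a≤)

-- Induction on the number `J` of branchings. In either block the total degree `a ℕ.+ b` drops by
-- one, which the witnesses of a branching respect by being strictly shorter than the bound.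
wide : ∀ {n} (φ : 3CNF n) → ¬ Satisfiable φ → ∀ J {a b} {ℓ : Word n → F₂} → Functional ℓ →
  Annihilates φ J ℓ → J < a → J < b → ∀ w → length w ≤ a ℕ.+ b → ℓ w ≡ 1ℙ → Wide (2 ^ J) a b ℓ
wide φ unsat zero {a} {b} {ℓ} F ann J<a J<b w w≤ ℓw =
  -- Cutting `w` after `a` letters exhibits a single entry 1 of the moment matrix.
  Wide-mono {ℓ = ℓ}
    (ℕ.≤-trans (ℕ.≤-reflexive (List.length-take a w)) (ℕ.m⊓n≤m a (length w)))
    (ℕ.≤-trans (ℕ.≤-reflexive (List.length-drop a w)) (ℕ.m≤n+o⇒m∸n≤o (length w) a w≤))
    (Wide-1 ℓ (take a w) (drop a w) (trans (cong ℓ (List.take++drop≡id a w)) ℓw))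
wide φ unsat (suc J) {suc a} {suc b} {ℓ} F ann (s≤s J<a) (s≤s J<b) w w≤ ℓw
  with branching φ unsat F (Annihilates-mono φ {ℓ} z≤n ann) w ℓw
... | x , (u , u< , ℓu) , (v , v< , ℓv) =
  subst (λ R → Wide R (suc a) (suc b) ℓ) (cong (2 ^ J ℕ.+_) (sym (ℕ.+-identityʳ (2 ^ J))))
    (Wide-+ F x
      (wide φ unsat J (shift x F) (Annihilates-shift φ F x ann) (ℕ.m<n⇒m<1+n J<a) J<b u
        (ℕ.≤-trans (short u<) (ℕ.≤-reflexive (ℕ.+-suc a b))) ℓu)
      (wide φ unsat J (shift (flip x) F) (Annihilates-shift φ F (flip x) ann) J<a (ℕ.m<n⇒m<1+n J<b) v
        (short v<) ℓv))
  where
  short : ∀ {m} → m < length w ℕ.⊔ 3 → m ≤ a ℕ.+ suc b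
  -- The bound 3 from the clauses also fits, since `J<a` makes `a` positive.
  short m< = ℕ.s≤s⁻¹ (ℕ.≤-trans m< (ℕ.⊔-lub w≤
    (s≤s (ℕ.+-mono-≤ (ℕ.≤-trans (s≤s z≤n) J<a) (s≤s (ℕ.≤-trans z≤n J<b))))))

-- Interpolation

variableOf : ∀ {n} → Literal n → Fin n
variableOf (pos x) = x
variableOf (neg x) = x

-- Only the variables of the literals matter here, not their signs.

point : ∀ {n} → Word n → Assignment n
point []      x = false
point (l ∷ W) x = (toℕ (variableOf l) ≡ᵇ toℕ x) ∨ point W x

ev-cong : ∀ {n} {α β : Assignment n} → (∀ x → α x ≡ β x) → ∀ V → ev α V ≡ ev β V
ev-cong α≗β []          = refl
ev-cong α≗β (pos x ∷ V) = cong₂ (λ a p → fromBool (not a) * p) (α≗β x) (ev-cong α≗β V)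
ev-cong α≗β (neg x ∷ V) = cong₂ (λ a p → fromBool (not (not a)) * p) (α≗β x) (ev-cong α≗β V)

≡ᵇ-true : ∀ {m n} → m ≡ n → (m ≡ᵇ n) ≡ true
≡ᵇ-true {m} {n} = dec-true (m ℕ.≟ n)

≡ᵇ-false : ∀ {m n} → m ≢ n → (m ≡ᵇ n) ≡ false
≡ᵇ-false {m} {n} = dec-false (m ℕ.≟ n)

point-pos-≢ : ∀ {n} {x y : Fin n} W → y ≢ x → point (pos y ∷ W) x ≡ point W x
point-pos-≢ {x = x} W y≢x = cong (_∨ point W x) (≡ᵇ-false (y≢x ∘ Fin.toℕ-injective))

point-pos-≡ : ∀ {n} (x : Fin n) W → point (pos x ∷ W) x ≡ true
point-pos-≡ x W = cong (_∨ point W x) (≡ᵇ-true {toℕ x} refl)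

sumOver : ∀ {A : Set} → (A → F₂) → List A → F₂
sumOver f []       = 0ℙ
sumOver f (x ∷ xs) = f x + sumOver f xs

sumOver-++ : ∀ {A : Set} (f : A → F₂) xs ys → sumOver f (xs ++ ys) ≡ sumOver f xs + sumOver f ys
sumOver-++ f []       ys = refl
sumOver-++ f (x ∷ xs) ys = trans (cong (f x +_) (sumOver-++ f xs ys)) (sym (+-assoc (f x) _ _))

sumOver-map : ∀ {A B : Set} (f : B → F₂) (g : A → B) xs → sumOver f (map g xs) ≡ sumOver (f ∘ g) xs
sumOver-map f g []       = refl
sumOver-map f g (x ∷ xs) = cong (f (g x) +_) (sumOver-map f g xs)

sumOver-+ : ∀ {A : Set} (f g : A → F₂) xs → sumOver f xs + sumOver g xs ≡ sumOver (λ x → f x + g x) xs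
sumOver-+ f g []       = refl
sumOver-+ f g (x ∷ xs) = trans (interchange (f x) _ (g x) _) (cong (f x + g x +_) (sumOver-+ f g xs))

sumOver-*ˡ : ∀ {A : Set} c (f : A → F₂) xs → sumOver (λ x → c * f x) xs ≡ c * sumOver f xs
sumOver-*ˡ c f []       = sym (zeroʳ c)
sumOver-*ˡ c f (x ∷ xs) = trans (cong (c * f x +_) (sumOver-*ˡ c f xs)) (sym (distribˡ c (f x) (sumOver f xs)))

sumOver-cong : ∀ {A : Set} {f g : A → F₂} {xs} → All (λ x → f x ≡ g x) xs → sumOver f xs ≡ sumOver g xs
sumOver-cong []         = refl
sumOver-cong (eq ∷ eqs) = cong₂ _+_ eq (sumOver-cong eqs)

about : ∀ {n} → Fin n → Word n → Word n
about y []      = []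
about y (l ∷ V) with variableOf l Fin.≟ y
... | yes _ = l ∷ about y V
... | no  _ = about y V

avoiding : ∀ {n} → Fin n → Word n → Word n
avoiding y []      = []
avoiding y (l ∷ V) with variableOf l Fin.≟ y
... | yes _ = avoiding y V
... | no  _ = l ∷ avoiding y V

-- Isolates the dependence on the value at `y`: the first factor sees the assignment at `y` only,
-- the second everywhere else.
ev-factorise : ∀ {n} (α : Assignment n) y V → ev α V ≡ ev α (about y V) * ev α (avoiding y V)
ev-factorise α y []      = refl
ev-factorise α y (l ∷ V) with variableOf l Fin.≟ y
... | yes _ = trans (cong (factor α l *_) (ev-factorise α y V))
  (sym (*-assoc (factor α l) (ev α (about y V)) (ev α (avoiding y V))))
... | no  _ = begin
  factor α l * ev α V                                  ≡⟨ cong (factor α l *_) (ev-factorise α y V) ⟩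
  factor α l * (ev α (about y V) * ev α (avoiding y V)) ≡⟨ *-assoc (factor α l) _ _ ⟨
  factor α l * ev α (about y V) * ev α (avoiding y V)   ≡⟨ cong (_* ev α (avoiding y V)) (*-comm (factor α l) _) ⟩
  ev α (about y V) * factor α l * ev α (avoiding y V)   ≡⟨ *-assoc (ev α (about y V)) _ _ ⟩
  ev α (about y V) * (factor α l * ev α (avoiding y V)) ∎
  where open ≡-Reasoning

length-avoiding : ∀ {n} (y : Fin n) V → length (avoiding y V) ≤ length V
length-avoiding y []      = z≤n
length-avoiding y (l ∷ V) with variableOf l Fin.≟ y
... | yes _ = ℕ.m≤n⇒m≤1+n (length-avoiding y V)
... | no  _ = s≤s (length-avoiding y V)

-- The dichotomy behind the degree drop: the difference of `V` in direction `y` vanishes in the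
-- first case, and is a multiple of a shorter word in the second.
about-or-shorter : ∀ {n} (y : Fin n) V → about y V ≡ [] ⊎ length (avoiding y V) < length V
about-or-shorter y []      = inj₁ refl
about-or-shorter y (l ∷ V) with variableOf l Fin.≟ y | about-or-shorter y V
... | yes _ | _            = inj₂ (s≤s (length-avoiding y V))
... | no  _ | inj₁ eq      = inj₁ eq
... | no  _ | inj₂ shorter = inj₂ (s≤s shorter)

factor-cong : ∀ {n} {α β : Assignment n} l → α (variableOf l) ≡ β (variableOf l) → factor α l ≡ factor β l
factor-cong (pos x) = cong (fromBool ∘ not)
factor-cong (neg x) = cong (fromBool ∘ not ∘ not)

ev-about : ∀ {n} {α β : Assignment n} y → α y ≡ β y → ∀ V → ev α (about y V) ≡ ev β (about y V)
ev-about y eq []      = refl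
ev-about y eq (l ∷ V) with variableOf l Fin.≟ y
... | yes refl = cong₂ _*_ (factor-cong l eq) (ev-about y eq V)
... | no  _    = ev-about y eq V

ev-avoiding : ∀ {n} (W : Word n) y V → ev (point (pos y ∷ W)) (avoiding y V) ≡ ev (point W) (avoiding y V)
ev-avoiding W y []      = refl
ev-avoiding W y (l ∷ V) with variableOf l Fin.≟ y
... | yes _  = ev-avoiding W y V
... | no l≢y = cong₂ _*_ (factor-cong l (point-pos-≢ W (l≢y ∘ sym))) (ev-avoiding W y V)

-- The values of a word of length at most L at the sets of at most L
-- elements determine its values at all sets: below, nodes L ys are subsets
-- of ys, and the recursion is f(y ∪ S) = f(S) + (f(S) + f(y ∪ S)), where
-- the bracket is a multiple of a word of length less than L.

nodes : ∀ {n} → ℕ → List (Fin n) → List (Word n)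
nodes zero    ys       = [] ∷ []
nodes (suc L) []       = [] ∷ []
nodes (suc L) (y ∷ ys) = nodes (suc L) ys ++ (nodes L ys ++ map (pos y ∷_) (nodes L ys))

length-nodes : ∀ {n} L (ys : List (Fin n)) → All (λ W → length W ≤ L) (nodes L ys)
length-nodes zero    ys       = z≤n ∷ []
length-nodes (suc L) []       = z≤n ∷ []
length-nodes (suc L) (y ∷ ys) = All.++⁺ (length-nodes (suc L) ys)
  (All.++⁺ (All.map ℕ.m≤n⇒m≤1+n (length-nodes L ys)) (All.map⁺ (All.map s≤s (length-nodes L ys))))

nodes-avoid : ∀ {n} L {y : Fin n} {ys} → All (y ≢_) ys → All (λ W → point W y ≡ false) (nodes L ys)
nodes-avoid zero    _          = refl ∷ []
nodes-avoid (suc L) []         = refl ∷ []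
nodes-avoid (suc L) (≢z ∷ ≢zs) = All.++⁺ (nodes-avoid (suc L) ≢zs)
  (All.++⁺ (nodes-avoid L ≢zs)
    (All.map⁺ (All.map (λ {W} eq → trans (point-pos-≢ W (≢z ∘ sym)) eq) (nodes-avoid L ≢zs))))

module _ {n : ℕ} (y : Fin n) (V : Word n) where

  private
    c₀ c₁ : F₂
    c₀ = ev (λ _ → false) (about y V)
    c₁ = ev (λ _ → true) (about y V)

    rest : Word n → F₂
    rest W = ev (point W) (avoiding y V)

  ev-without : ∀ W → point W y ≡ false → ev (point W) V ≡ c₀ * rest W
  ev-without W eq = trans (ev-factorise (point W) y V)
    (cong (_* rest W) (ev-about y eq V))

  ev-with : ∀ W → ev (point (pos y ∷ W)) V ≡ c₁ * rest W
  ev-with W = trans (ev-factorise (point (pos y ∷ W)) y V)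
    (cong₂ _*_ (ev-about y (point-pos-≡ y W) V) (ev-avoiding W y V))

  -- Pairing each node `W` with `pos y ∷ W` turns the sum into one of differences
  -- `(c₀ + c₁) * rest W`. Their degree is small enough for the interpolation hypothesis at level
  -- `L`.
  interpolation-step : ∀ {L ys} → All (y ≢_) ys → length V ≤ suc L →
    (∀ U → length U ≤ L → sumOver (λ W → ev (point W) U) (nodes L ys) ≡ ev (point (map pos ys)) U) →
    point (map pos ys) y ≡ false →
    sumOver (λ W → ev (point W) V) (nodes L ys ++ map (pos y ∷_) (nodes L ys)) ≡
    c₀ * rest (map pos ys) + c₁ * rest (map pos ys)
  interpolation-step {L} {ys} y∉ys V≤ IH ys-y = begin
    sumOver f (nodes L ys ++ map (pos y ∷_) (nodes L ys))
      ≡⟨ sumOver-++ f (nodes L ys) _ ⟩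
    sumOver f (nodes L ys) + sumOver f (map (pos y ∷_) (nodes L ys))
      ≡⟨ cong (sumOver f (nodes L ys) +_) (sumOver-map f (pos y ∷_) (nodes L ys)) ⟩
    sumOver f (nodes L ys) + sumOver (f ∘ (pos y ∷_)) (nodes L ys)
      ≡⟨ sumOver-+ f (f ∘ (pos y ∷_)) (nodes L ys) ⟩
    sumOver (λ W → f W + f (pos y ∷ W)) (nodes L ys)
      ≡⟨ sumOver-cong (All.map (λ {W} eq → trans
             (cong₂ _+_ (ev-without W eq) (ev-with W)) (sym (distribʳ (rest W) c₀ c₁)))
           (nodes-avoid L y∉ys)) ⟩
    sumOver (λ W → (c₀ + c₁) * rest W) (nodes L ys)
      ≡⟨ sumOver-*ˡ (c₀ + c₁) rest (nodes L ys) ⟩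
    (c₀ + c₁) * sumOver rest (nodes L ys)
      ≡⟨ collapse (about-or-shorter y V) ⟩
    (c₀ + c₁) * rest (map pos ys)
      ≡⟨ distribʳ (rest (map pos ys)) c₀ c₁ ⟩
    c₀ * rest (map pos ys) + c₁ * rest (map pos ys) ∎
    where
    open ≡-Reasoning
    f : Word n → F₂
    f W = ev (point W) V

    collapse : about y V ≡ [] ⊎ length (avoiding y V) < length V →
      (c₀ + c₁) * sumOver rest (nodes L ys) ≡ (c₀ + c₁) * rest (map pos ys)
    -- Here `y` does not occur in `V`, so `c₀` and `c₁` are both 1 and add up to 0.
    collapse (inj₁ eq) rewrite eq = refl
    collapse (inj₂ shorter) =
      cong ((c₀ + c₁) *_) (IH (avoiding y V) (ℕ.s≤s⁻¹ (ℕ.≤-trans shorter V≤)))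

point-∉ : ∀ {n} {y : Fin n} {ys} → All (y ≢_) ys → point (map pos ys) y ≡ false
point-∉ []                           = refl
point-∉ {ys = z ∷ ys} (y≢z ∷ y≢zs) = trans (point-pos-≢ (map pos ys) (y≢z ∘ sym)) (point-∉ y≢zs)

point-∈ : ∀ {n} {y : Fin n} {ys} → y ∈ ys → point (map pos ys) y ≡ true
point-∈ {y = y} {_ ∷ ys} (here refl) = point-pos-≡ y (map pos ys)
point-∈ {y = y} {z ∷ ys} (there y∈)  =
  trans (cong ((toℕ z ≡ᵇ toℕ y) ∨_) (point-∈ y∈)) (Bool.∨-zeroʳ (toℕ z ≡ᵇ toℕ y))

F₂-double : ∀ a → a + a ≡ 0ℙ
F₂-double 0ℙ = refl
F₂-double 1ℙ = refl

interpolate : ∀ {n} L {ys : List (Fin n)} → Unique ys → ∀ V → length V ≤ L →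
  sumOver (λ W → ev (point W) V) (nodes L ys) ≡ ev (point (map pos ys)) V
interpolate zero    unique         []  _  = refl
interpolate (suc L) []             V   V≤ = +-identityʳ _
interpolate {n} (suc L) {y ∷ ys} (y∉ys ∷ unique) V V≤ = begin
  sumOver f (nodes (suc L) ys ++ new)         ≡⟨ sumOver-++ f (nodes (suc L) ys) new ⟩
  sumOver f (nodes (suc L) ys) + sumOver f new
    ≡⟨ cong₂ _+_ (trans (interpolate (suc L) unique V V≤) (ev-without y V (map pos ys) ys-y))
         (interpolation-step y V y∉ys V≤ (interpolate L unique) ys-y) ⟩
  -- The value at `ys` is `u`, the value at `ys` together with `y` is `v`, and `u` cancels in
  -- characteristic 2.
  u + (u + v)                                 ≡⟨ +-assoc u u v ⟨
  u + u + v                                   ≡⟨ cong (_+ v) (F₂-double u) ⟩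
  v                                           ≡⟨ ev-with y V (map pos ys) ⟨
  ev (point (pos y ∷ map pos ys)) V           ∎
  where
  open ≡-Reasoning
  f : Word n → F₂
  f W = ev (point W) V
  new : List (Word n)
  new = nodes L ys ++ map (pos y ∷_) (nodes L ys)
  u v : F₂
  u = ev (λ _ → false) (about y V) * ev (point (map pos ys)) (avoiding y V)
  v = ev (λ _ → true) (about y V) * ev (point (map pos ys)) (avoiding y V)
  ys-y : point (map pos ys) y ≡ false
  ys-y = point-∉ y∉ys

trueVariables : ∀ {n} → Assignment n → List (Fin n)
trueVariables {n} α = filter (λ x → α x Bool.≟ true) (allFin n)

point-trueVariables : ∀ {n} (α : Assignment n) x → point (map pos (trueVariables α)) x ≡ α x
point-trueVariables α x with α x in αx
... | true  = point-∈ (∈-filter⁺ (λ x → α x Bool.≟ true) (∈-allFin x) αx)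
... | false = point-∉ (All.tabulate λ {y} y∈ x≡y →
  contradiction (trans (sym αx) (trans (cong α x≡y)
    (proj₂ (∈-filter⁻ (λ x → α x Bool.≟ true) {xs = allFin _} y∈)))) λ ())

-- Although `α` may have many ones, on short words its evaluation is a sum of evaluations at points
-- with at most `L` ones. This places the satisfying solution in the span of the generators.
ev-interpolated : ∀ {n} L (α : Assignment n) V → length V ≤ L →
  sumOver (λ W → ev (point W) V) (nodes L (trueVariables α)) ≡ ev α V
ev-interpolated L α V V≤ = trans
  (interpolate L (Unique.filter⁺ (λ x → α x Bool.≟ true) (Unique.allFin⁺ _)) V V≤)
  (ev-cong (point-trueVariables α) V)

moment : ∀ {n m} → Vector F₂ m → (Fin m → Word n) → Word n → F₂
moment a W V = sum₂ (λ w → a w * ev (point (W w)) V)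

moment-functional : ∀ {n m} (a : Vector F₂ m) (W : Fin m → Word n) → Functional (moment a W)
moment-functional {m = m} a W = record
  { ℓ-cong  = λ U V eq → sum-cong-≗ λ w → cong (a w *_) (eq (point (W w)))
  ; ℓ-zero  = λ U eq → trans (sum-cong-≗ λ w → trans (cong (a w *_) (eq (point (W w)))) (zeroʳ (a w)))
      (sum-replicate-zero m)
  ; ℓ-split = λ l V → trans
      (sym (∑-distrib-+ (λ w → a w * ev (point (W w)) (l ∷ V)) (λ w → a w * ev (point (W w)) (flip l ∷ V))))
      (sum-cong-≗ λ w → trans (sym (distribˡ (a w) (ev (point (W w)) (l ∷ V)) (ev (point (W w)) (flip l ∷ V))))
        (cong (a w *_) (trans
          (sym (distribʳ (ev (point (W w)) V) (factor (point (W w)) l) (factor (point (W w)) (flip l))))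
          (cong (_* ev (point (W w)) V) (factor-flip (point (W w)) l)))))
  }

-- The generating matrices

-- The descending order is the one in which the program `literalsᵀ` builds this list by prepending.
literalsBelow : ∀ {n} m → m ≤ n → List (Literal n)
literalsBelow zero    _   = []
literalsBelow (suc m) m<n = pos (fromℕ< m<n) ∷ neg (fromℕ< m<n) ∷ literalsBelow m (ℕ.<⇒≤ m<n)

literals : ∀ n → List (Literal n)
literals n = literalsBelow n ℕ.≤-refl

∈-literalsBelow : ∀ {n} m (m≤n : m ≤ n) l → toℕ (variableOf l) < m → l ∈ literalsBelow m m≤n
∈-literalsBelow (suc m) m<n l l< with toℕ (variableOf l) ℕ.≟ m
∈-literalsBelow (suc m) m<n (pos x) l< | yes eq =
  here (cong pos (Fin.toℕ-injective (trans eq (sym (Fin.toℕ-fromℕ< m<n)))))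
∈-literalsBelow (suc m) m<n (neg x) l< | yes eq =
  there (here (cong neg (Fin.toℕ-injective (trans eq (sym (Fin.toℕ-fromℕ< m<n))))))
... | no ≢m = there (there (∈-literalsBelow m (ℕ.<⇒≤ m<n) l (ℕ.≤∧≢⇒< (ℕ.s≤s⁻¹ l<) ≢m)))

∈-literals : ∀ {n} (l : Literal n) → l ∈ literals n
∈-literals l = ∈-literalsBelow _ ℕ.≤-refl l (Fin.toℕ<n (variableOf l))

-- Permutations and repetitions of letters are kept: redundant rows, columns and generators are
-- harmless, and plain nested loops enumerate the list.
words : ∀ {A : Set} → List A → ℕ → List (List A)
words ls zero    = [] ∷ []
words ls (suc d) = concatMap (λ l → map (l ∷_) (words ls d)) ls ++ [] ∷ []

∈-words : ∀ {A : Set} {ls : List A} → (∀ l → l ∈ ls) → ∀ {d} w → length w ≤ d → w ∈ words ls d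
∈-words all {zero}       []      _   = here refl
∈-words {ls = ls} all {suc d} []      _   = ∈-++⁺ʳ (concatMap (λ l → map (l ∷_) (words ls d)) ls) (here refl)
∈-words all {suc d}      (l ∷ w) w≤  = ∈-++⁺ˡ
  (∈-concatMap⁺ _ (lose (all l) (∈-map⁺ (l ∷_) (∈-words all w (ℕ.s≤s⁻¹ w≤)))))

words-length : ∀ {A : Set} (ls : List A) d {w} → w ∈ words ls d → length w ≤ d
words-length ls zero    (here refl) = z≤n
words-length ls (suc d) w∈ with ∈-++⁻ (concatMap (λ l → map (l ∷_) (words ls d)) ls) w∈
... | inj₂ (here refl) = z≤n
... | inj₁ w∈′ with find (∈-concatMap⁻ (λ l → map (l ∷_) (words ls d)) {xs = ls} w∈′)
...   | l , _ , w∈″ with ∈-map⁻ (l ∷_) w∈″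
...     | v , v∈ , refl = s≤s (words-length ls d v∈)

-- Rows and columns are indexed by labelled words, and entries with distinct
-- labels vanish.  Label 0 carries the moment matrix; the labels 1, …, K carry
-- copies of the block of all ℓ(S·T) with S and T multiples of clauses.

Item : ℕ → Set
Item n = ℕ × Word n

penalties : ∀ {n} → List (Clause n) → ℕ → List (Word n) → List (Item n)
penalties cls K ws = concatMap (λ i → concatMap (λ C → map (λ q → i , Vec.toList C ++ q) ws) cls) (applyUpTo suc K)

items : ∀ {n} → 3CNF n → ℕ → ℕ → List (Item n)
items {n} φ K d = penalties (3CNF.clauses φ) K (words (literals n) d) ++ map (0 ,_) (words (literals n) d)

data Valid {n} (φ : 3CNF n) (K d : ℕ) : Item n → Set where
  main    : ∀ {S} → length S ≤ d → Valid φ K d (0 , S)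
  penalty : ∀ {i C q} → i < K → C ∈ 3CNF.clauses φ → length q ≤ d → Valid φ K d (suc i , Vec.toList C ++ q)

∈-items : ∀ {n} (φ : 3CNF n) {K d x} → Valid φ K d x → x ∈ items φ K d
∈-items {n} φ {K} {d} (main S≤) =
  ∈-++⁺ʳ (penalties (3CNF.clauses φ) K (words (literals n) d)) (∈-map⁺ (0 ,_) (∈-words ∈-literals _ S≤))
∈-items φ (penalty i<K C∈ q≤) = ∈-++⁺ˡ (∈-concatMap⁺ _ (lose (∈-applyUpTo⁺ suc i<K)
  (∈-concatMap⁺ _ (lose C∈ (∈-map⁺ _ (∈-words ∈-literals _ q≤))))))

items-valid : ∀ {n} (φ : 3CNF n) K d {x} → x ∈ items φ K d → Valid φ K d x
items-valid {n} φ K d x∈ with ∈-++⁻ (penalties (3CNF.clauses φ) K (words (literals n) d)) x∈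
... | inj₂ x∈′ with ∈-map⁻ (0 ,_) x∈′
...   | S , S∈ , refl = main (words-length (literals n) d S∈)
items-valid {n} φ K d x∈ | inj₁ x∈′
  with find (∈-concatMap⁻
    (λ i → concatMap (λ C → map (λ q → i , Vec.toList C ++ q) (words (literals n) d)) (3CNF.clauses φ))
    {xs = applyUpTo suc K} x∈′)
... | _ , i∈ , x∈″ with ∈-applyUpTo⁻ suc i∈
  | find (∈-concatMap⁻ (λ C → map (λ q → _ , Vec.toList C ++ q) (words (literals n) d)) {xs = 3CNF.clauses φ} x∈″)
...   | i , i<K , refl | C , C∈ , x∈‴ with ∈-map⁻ (λ q → suc i , Vec.toList C ++ q) x∈‴
...     | q , q∈ , refl = penalty i<K C∈ (words-length (literals n) d q∈)

entry : ∀ {n} → Word n → Item n → Item n → F₂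
entry W (i , S) (j , T) = fromBool (i ≡ᵇ j) * (ev (point W) S * ev (point W) T)

generators : ∀ {n} (φ : 3CNF n) K d L → Vector (Matrix (length (items φ K d))) (length (words (literals n) L))
generators {n} φ K d L w (i , j) =
  entry (lookup (words (literals n) L) w) (lookup (items φ K d) i) (lookup (items φ K d) j)

valid-lookup : ∀ {n} (φ : 3CNF n) {K d} i → Valid φ K d (lookup (items φ K d) i)
valid-lookup φ {K} {d} i = items-valid φ K d (∈-lookup i)

position : ∀ {n} (φ : 3CNF n) {K d x} → Valid φ K d x → ∃[ i ] lookup (items φ K d) i ≡ x
position φ v = ListAny.index (∈-items φ v) , sym (ListAny.lookup-index (∈-items φ v))

-- Satisfiable formulas

Span-sumOver : ∀ {I m} {A : Set} (v : Vector (Space I) m) (f : A → Space I) xs →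
  (∀ x → x ∈ xs → Span v (f x)) → Span v (λ i → sumOver (λ x → f x i) xs)
Span-sumOver v f []       spans = Span-𝟎 v
Span-sumOver v f (x ∷ xs) spans =
  Span-+ v (spans x (here refl)) (Span-sumOver v f xs (λ y y∈ → spans y (there y∈)))

ev-satisfied : ∀ {n m} {α : Assignment n} (C : Vec (Literal n) m) q →
  VecAny.Any (λ l → evalLiteral α l ≡ true) C → ev α (Vec.toList C ++ q) ≡ 0ℙ
ev-satisfied {α = α} (l ∷ C) q (VecAny.here eq)  =
  cong (λ b → fromBool (not b) * ev α (Vec.toList C ++ q)) eq
ev-satisfied {α = α} (l ∷ C) q (VecAny.there sat) =
  trans (cong (factor α l *_) (ev-satisfied C q sat)) (zeroʳ (factor α l))

length-item : ∀ {n} {φ : 3CNF n} {K d x} → Valid φ K d x → length (proj₂ x) ≤ 3 ℕ.+ d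
length-item (main S≤) = ℕ.≤-trans S≤ (ℕ.m≤n+m _ 3)
length-item (penalty {C = _ ∷ _ ∷ _ ∷ []} _ _ q≤) = s≤s (s≤s (s≤s q≤))

-- An item has at most `3 ℕ.+ d` letters, so `d+d≤L` lets interpolation reach every product of a row
-- word and a column word.
module _ {n : ℕ} (φ : 3CNF n) {K d L : ℕ} (α : Assignment n) (sat : Satisfies α φ)
  (d+d≤L : (3 ℕ.+ d) ℕ.+ (3 ℕ.+ d) ≤ L) where

  ε : Item n → F₂
  ε (zero  , S) = ev α S
  ε (suc _ , S) = 0ℙ

  interpolated : List (Word n)
  interpolated = nodes L (trueVariables α)

  solution : Matrix (length (items φ K d))
  solution (i , j) = sumOver (λ W → entry W (lookup (items φ K d) i) (lookup (items φ K d) j)) interpolated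

  solution∈Span : Span (generators φ K d L) solution
  solution∈Span = Span-sumOver (generators φ K d L) _ interpolated λ W W∈ →
    let W∈′ = ∈-words ∈-literals W (All.lookup (length-nodes L (trueVariables α)) W∈) in
    Span-resp (λ (i , j) → cong (λ U → entry U (lookup (items φ K d) i) (lookup (items φ K d) j))
        (sym (ListAny.lookup-index W∈′)))
      (∈-Span (generators φ K d L) (ListAny.index W∈′))

  sumOver-ev : ∀ S T → length S ≤ 3 ℕ.+ d → length T ≤ 3 ℕ.+ d →
    sumOver (λ W → ev (point W) S * ev (point W) T) interpolated ≡ ev α S * ev α T
  sumOver-ev S T S≤ T≤ = begin
    sumOver (λ W → ev (point W) S * ev (point W) T) interpolated
      ≡⟨ sumOver-cong (All.universal (λ W → sym (ev-++ (point W) S T)) interpolated) ⟩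
    sumOver (λ W → ev (point W) (S ++ T)) interpolated
      ≡⟨ ev-interpolated L α (S ++ T) (ℕ.≤-trans (ℕ.≤-reflexive (List.length-++ S))
           (ℕ.≤-trans (ℕ.+-mono-≤ S≤ T≤) d+d≤L)) ⟩
    ev α (S ++ T)
      ≡⟨ ev-++ α S T ⟩
    ev α S * ev α T ∎
    where open ≡-Reasoning

  sumOver-0 : sumOver (λ _ → 0ℙ) interpolated ≡ 0ℙ
  sumOver-0 = sumOver-*ˡ 0ℙ (λ _ → 0ℙ) interpolated

  -- In the penalty blocks every word contains a clause satisfied by `α` and so evaluates to 0. Only
  -- the main block survives, as the outer product of `ev α` with itself.
  sumOver-entry : ∀ x y → Valid φ K d x → Valid φ K d y →
    sumOver (λ W → entry W x y) interpolated ≡ ε x * ε y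
  sumOver-entry (_ , S) (_ , T) v@(main _) w@(main _) = sumOver-ev S T (length-item v) (length-item w)
  sumOver-entry (_ , S) _ (main _) (penalty _ _ _) = trans sumOver-0 (sym (zeroʳ (ev α S)))
  sumOver-entry _ _ (penalty _ _ _) (main _) = sumOver-0
  sumOver-entry (suc i , S) (suc j , T) v@(penalty {C = C} {q} _ C∈ _) w@(penalty _ _ _) with i ≡ᵇ j
  ... | false = sumOver-0
  ... | true  = trans (sumOver-ev S T (length-item v) (length-item w))
    (cong (_* ev α T) (ev-satisfied C q (All.lookup sat C∈)))

  -- The empty word evaluates to 1 at every assignment. Its position shows that the solution is
  -- nonzero and serves as the pivot for rank 1.
  origin : ∃[ i ] lookup (items φ K d) i ≡ (0 , [])
  origin = position φ {K} {d} (main z≤n)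

  satisfiable⇒rank-1 : ∃[ M ] Span (generators φ K d L) M × NonZeroVector M × HasRank M 1
  satisfiable⇒rank-1 = solution , solution∈Span , nonZero ,
    rank-one (ε ∘ lookup (items φ K d)) (proj₁ origin) ε-origin solution entries
    where
    entries : ∀ i j → solution (i , j) ≡ ε (lookup (items φ K d) i) * ε (lookup (items φ K d) j)
    entries i j = sumOver-entry _ _ (valid-lookup φ i) (valid-lookup φ j)

    ε-origin : ε (lookup (items φ K d) (proj₁ origin)) ≡ 1ℙ
    ε-origin = cong ε (proj₂ origin)

    nonZero : NonZeroVector solution
    nonZero eq with trans (sym (eq (proj₁ origin , proj₁ origin)))
      (trans (entries (proj₁ origin) (proj₁ origin)) (cong₂ _*_ ε-origin ε-origin))
    ... | ()

-- Unsatisfiable formulas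

combine-vec-lookup : ∀ {R} {C : Set} (f : C → F₂) (α : Vec F₂ R) (g : Fin R → C) →
  combine-vec f α (Vec.tabulate g) ≡ sum₂ (λ j → f (g j) * Vec.lookup α j)
combine-vec-lookup f []      g = refl
combine-vec-lookup f (a ∷ α) g = cong₂ _+_ (*-comm a (f (g zero))) (combine-vec-lookup f α (g ∘ suc))

diagonal-independent : ∀ {X C : Set} {R} {P : X → Set} (M : X → C → F₂) (g : Fin R → C) (x : Fin R → X) →
  (∀ i → P (x i)) → (∀ i j → M (x i) (g j) ≡ δ i j) → Independent P M (Vec.tabulate g)
diagonal-independent M g x P-x M≡δ α β eq = begin
  α                             ≡⟨ Vec.tabulate∘lookup α ⟨
  Vec.tabulate (Vec.lookup α)   ≡⟨ Vec.tabulate-cong (λ i → trans (sym (coordinate i α))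
                                     (trans (eq (x i) (P-x i)) (coordinate i β))) ⟩
  Vec.tabulate (Vec.lookup β)   ≡⟨ Vec.tabulate∘lookup β ⟩
  β                             ∎
  where
  open ≡-Reasoning
  coordinate : ∀ i γ → combine-vec (M (x i)) γ (Vec.tabulate g) ≡ Vec.lookup γ i
  coordinate i γ = trans (combine-vec-lookup (M (x i)) γ g)
    (trans (sum-cong-≗ (λ j → cong (_* Vec.lookup γ j) (M≡δ i j))) (sum-δ i (Vec.lookup γ)))

combine-vec-congᴬ : ∀ {R} {C : Set} {f g : C → F₂} (α : Vec F₂ R) {cs} →
  VecAll.All (λ c → f c ≡ g c) cs → combine-vec f α cs ≡ combine-vec g α cs
combine-vec-congᴬ []      VecAll.[]          = refl
combine-vec-congᴬ (a ∷ α) (eq VecAll.∷ eqs) = cong₂ (λ x y → a * x + y) eq (combine-vec-congᴬ α eqs)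

δ-≡ᵇ : ∀ {m} (i j : Fin m) → fromBool (toℕ i ≡ᵇ toℕ j) * 1ℙ ≡ δ i j
δ-≡ᵇ zero    zero    = refl
δ-≡ᵇ zero    (suc _) = refl
δ-≡ᵇ (suc _) zero    = refl
δ-≡ᵇ (suc i) (suc j) = δ-≡ᵇ i j

F₂-idem : ∀ a → a * a ≡ a
F₂-idem 0ℙ = refl
F₂-idem 1ℙ = refl

module _ {n : ℕ} (φ : 3CNF n) {k K d J L : ℕ} 
  (unsat : ¬ Satisfiable φ) (k<K : k < K) (k<2^J : k < 2 ^ J) (J<d : J < d)
  (M : Matrix (length (items φ K d))) (a : Vector F₂ (length (words (literals n) L)))
  (M≗ : M ≗ combination a (generators φ K d L)) (rank≤k : RankAtMost M k) where

  private
    ℓ : Word n → F₂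
    ℓ = moment a (lookup (words (literals n) L))

    ℓ-functional : Functional ℓ
    ℓ-functional = moment-functional a (lookup (words (literals n) L))

    open Functional ℓ-functional

    block : Item n → Item n → F₂
    block (i , S) (j , T) = fromBool (i ≡ᵇ j) * (ℓ (S ++ T))

    moment-entry : ∀ x y → sum₂ (λ w → a w * entry (lookup (words (literals n) L) w) x y) ≡ block x y
    moment-entry (i , S) (j , T) with i ≡ᵇ j
    ... | true  = sum-cong-≗ λ w → cong (a w *_) (sym (ev-++ (point (lookup (words (literals n) L) w)) S T))
    ... | false = trans (sum-cong-≗ λ w → zeroʳ (a w)) (sum-replicate-zero (length (words (literals n) L)))

    M-block : ∀ i j → M (i , j) ≡ block (lookup (items φ K d) i) (lookup (items φ K d) j)
    M-block i j = trans (M≗ (i , j)) (moment-entry (lookup (items φ K d) i) (lookup (items φ K d) j))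

    M-position : ∀ {x y} (v : Valid φ K d x) (w : Valid φ K d y) →
      M (proj₁ (position φ v) , proj₁ (position φ w)) ≡ block x y
    M-position v w = trans (M-block _ _) (cong₂ block (proj₂ (position φ v)) (proj₂ (position φ w)))

    -- A nonzero entry in a penalty block occurs in all K of them.

    penalty-zero : ∀ {C q C′ q′} →
      C ∈ 3CNF.clauses φ → length q ≤ d → C′ ∈ 3CNF.clauses φ → length q′ ≤ d →
      ℓ ((Vec.toList C ++ q) ++ (Vec.toList C′ ++ q′)) ≡ 0ℙ
    penalty-zero {C} {q} {C′} {q′} C∈ q≤ C′∈ q′≤
      with zero-or-one (ℓ ((Vec.toList C ++ q) ++ (Vec.toList C′ ++ q′)))
    ... | inj₁ ℓ0 = ℓ0
    ... | inj₂ ℓ1 = contradiction k<K (ℕ.≤⇒≯ (RankAtMost⇒≤ M {λ _ → ⊤} (Vec.tabulate column) rank≤k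
      (diagonal-independent (λ i j → M (i , j)) column row (λ _ → _) λ i j → trans
        (M-position (penalty (Fin.toℕ<n i) C∈ q≤) (penalty (Fin.toℕ<n j) C′∈ q′≤))
        (trans (cong (fromBool (toℕ i ≡ᵇ toℕ j) *_) ℓ1) (δ-≡ᵇ i j)))))
      where
      row column : Fin K → Fin (length (items φ K d))
      row    i = proj₁ (position φ (penalty (Fin.toℕ<n i) C∈ q≤))
      column i = proj₁ (position φ (penalty (Fin.toℕ<n i) C′∈ q′≤))

    -- As a function `V` is idempotent, so `ℓ V` is a diagonal entry of a penalty block.
    annihilates : Annihilates φ d ℓ
    annihilates C C∈ q q≤ = trans
      (ℓ-cong V (V ++ V) λ α → trans (sym (F₂-idem (ev α V))) (sym (ev-++ α V V)))
      (penalty-zero C∈ q≤ C∈ q≤)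
      where
      V : Word n
      V = Vec.toList C ++ q

    mainPosition : Word n → Fin (length (items φ K d))
    mainPosition S with length S ℕ.≤? d
    ... | yes S≤ = proj₁ (position φ {K} {d} (main {S = S} S≤))
    -- A default that makes the map total; the rows and columns selected below all have words of
    -- length at most `d`.
    ... | no  _  = proj₁ (position φ {K} {d} (main {S = []} z≤n))

    lookup-mainPosition : ∀ S → length S ≤ d → lookup (items φ K d) (mainPosition S) ≡ (0 , S)
    lookup-mainPosition S S≤ with length S ℕ.≤? d
    ... | yes S≤′ = proj₂ (position φ {K} {d} (main {S = S} S≤′))
    ... | no  S≰  = contradiction S≤ S≰

    -- A moment equal to 1 would start `J` levels of branching, and the resulting `2 ^ J`
    -- independent columns would exceed the rank bound `k`.
    main-zero : ∀ {S T} → length S ≤ d → length T ≤ d → ℓ (S ++ T) ≡ 0ℙ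
    main-zero {S} {T} S≤ T≤ with zero-or-one (ℓ (S ++ T))
    ... | inj₁ ℓ0 = ℓ0
    ... | inj₂ ℓ1 with wide φ unsat J ℓ-functional (Annihilates-mono φ {ℓ} (ℕ.<⇒≤ J<d) annihilates) J<d J<d
                         (S ++ T) (ℕ.≤-trans (ℕ.≤-reflexive (List.length-++ S)) (ℕ.+-mono-≤ S≤ T≤)) ℓ1
    ...   | cs , cs≤ , indep = contradiction k<2^J
      (ℕ.≤⇒≯ (RankAtMost⇒≤ M {λ _ → ⊤} (Vec.map mainPosition cs) rank≤k λ α β eq → indep α β λ p p≤ →
        trans (sym (row p p≤ α)) (trans (eq (mainPosition p) _) (row p p≤ β))))
      where
      row : ∀ p → length p ≤ d → ∀ γ →
        combine-vec (λ j → M (mainPosition p , j)) γ (Vec.map mainPosition cs) ≡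
        combine-vec (λ c → ℓ (p ++ c)) γ cs
      row p p≤ γ = trans (combine-vec-map (λ j → M (mainPosition p , j)) mainPosition γ cs)
        (combine-vec-congᴬ γ (VecAll.map (λ {c} c≤ → trans (M-block (mainPosition p) (mainPosition c))
          (cong₂ block (lookup-mainPosition p p≤) (lookup-mainPosition c c≤))) cs≤))

    block-zero : ∀ x y → Valid φ K d x → Valid φ K d y → block x y ≡ 0ℙ
    block-zero (_ , S) (_ , T) (main S≤) (main T≤) = main-zero {S} {T} S≤ T≤
    block-zero _ _ (main _) (penalty _ _ _) = refl
    block-zero _ _ (penalty _ _ _) (main _) = refl
    block-zero (suc i , _) (suc j , _) (penalty _ C∈ q≤) (penalty _ C′∈ q′≤) with i ≡ᵇ j
    ... | true  = penalty-zero C∈ q≤ C′∈ q′≤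
    ... | false = refl

  unsatisfiable⇒zero : M ≗ 𝟎
  unsatisfiable⇒zero (i , j) = trans (M-block i j) (block-zero _ _ (valid-lookup φ i) (valid-lookup φ j))

-- Compilation to WHILE

-- A first-order functional language compiled to WHILE.  A term maps an
-- environment, a tree, to a value.  The body of a loop sees the current
-- element, the accumulator and the remaining environment.

data Term : Set where
  ret  : Expr 1 → Term
  on   : Expr 1 → Term → Term
  bind : Term → Term → Term
  cond : Expr 1 → Term → Term → Term
  loop : Term → Term

embed : Expr 1 → Expr 2
embed (var _)    = var zero
embed nil        = nil
embed (cons e f) = cons (embed e) (embed f)
embed (hd e)     = hd (embed e)
embed (tl e)     = tl (embed e)

-- Register zero holds the environment or value, register one a stack.

push pop enter next prepare transfer turn finish : Command 2
push     = suc zero ≔ cons (var zero) (var (suc zero))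
pop      = suc zero ≔ tl (var (suc zero))
enter    = zero ≔ cons (hd (hd (var zero))) (tl (var zero))
next     = zero ≔ cons (tl (hd (hd (var (suc zero))))) (cons (var zero) (tl (tl (hd (var (suc zero))))))
prepare  = zero ≔ cons (cons (hd (var zero)) nil) (tl (var zero))
transfer = zero ≔ cons (cons (tl (hd (hd (var zero)))) (cons (hd (hd (hd (var zero)))) (tl (hd (var zero)))))
  (tl (var zero))
turn     = zero ≔ cons (tl (hd (var zero))) (tl (var zero))
finish   = zero ≔ hd (tl (var zero))

extend : Command 2
extend = zero ≔ cons (var zero) (hd (var (suc zero)))

-- A loop first reverses its list, in order to compute a right fold.

compile : Term → Command 2
compile (ret e)      = zero ≔ embed e
compile (on e t)     = (zero ≔ embed e) ⨾ compile t
compile (bind t u)   = push ⨾ compile t ⨾ extend ⨾ pop ⨾ compile u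
compile (cond e t u) = if embed e then compile t else compile u
compile (loop t)     =
  prepare ⨾ (while hd (hd (var zero)) loop transfer) ⨾ turn ⨾
  (while hd (var zero) loop (push ⨾ enter ⨾ compile t ⨾ next ⨾ pop)) ⨾ finish

⟦embed⟧ : ∀ e x st → ⟦ embed e ⟧ (x ∷ st ∷ []) ≡ ⟦ e ⟧ (x ∷ [])
⟦embed⟧ (var zero) x st = refl
⟦embed⟧ nil        x st = refl
⟦embed⟧ (cons e f) x st = cong₂ _∙_ (⟦embed⟧ e x st) (⟦embed⟧ f x st)
⟦embed⟧ (hd e)     x st = cong head (⟦embed⟧ e x st)
⟦embed⟧ (tl e)     x st = cong tail (⟦embed⟧ e x st)

-- Running times are bounded by Q ^ a, where Q ≥ 2 bounds the number of
-- iterations of each loop.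

infixr 6 _⊕_

_⊕_ : ℕ → ℕ → ℕ
a ⊕ b = suc (a ℕ.+ b)

-- Applied to the named assignments only; the second clause is a dummy value.
time : Command 2 → ℕ
time (_ ≔ e) = suc (cost e)
time _       = 0

exponent : Term → ℕ
exponent (ret e)      = suc (cost (embed e))
exponent (on e t)     = suc (cost (embed e)) ⊕ exponent t
exponent (bind t u)   = time push ⊕ exponent t ⊕ time extend ⊕ time pop ⊕ exponent u
exponent (cond e t u) = suc (cost (embed e)) ⊕ (exponent t ℕ.+ exponent u)
exponent (loop t)     =
  -- Each `2` pays for at most `Q + 1`, hence at most `Q ^ 2`, tests of a guard. The `4` and the `3`
  -- are the times of one test of the two guards.
  time prepare ⊕ (2 ℕ.+ (4 ⊕ time transfer)) ⊕ time turn ⊕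
  (2 ℕ.+ (3 ⊕ (time push ⊕ time enter ⊕ exponent t ⊕ time next ⊕ time pop))) ⊕ time finish

-- Time bounds for compiled terms

n<2^n : ∀ n → n < 2 ^ n
n<2^n zero    = s≤s z≤n
n<2^n (suc n) = ℕ.≤-trans (ℕ.+-mono-≤ (ℕ.≤-trans (s≤s z≤n) (n<2^n n)) (n<2^n n))
  (ℕ.+-monoʳ-≤ (2 ^ n) (ℕ.m≤m+n (2 ^ n) 0))

∈-ʳ++ : ∀ {A : Set} {x : A} {ps} ys → x ∈ ps → x ∈ ys ʳ++ ps
∈-ʳ++ []       x∈ = x∈
∈-ʳ++ (y ∷ ys) x∈ = ∈-ʳ++ ys (there x∈)

length-ʳ++-≤ : ∀ {A : Set} (ys : List A) {ps} → length ps ≤ length (ys ʳ++ ps)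
length-ʳ++-≤ []       = ℕ.≤-refl
length-ʳ++-≤ (y ∷ ys) = ℕ.≤-trans (ℕ.n≤1+n _) (length-ʳ++-≤ ys)

encodeℕ-list : ∀ m → encodeList (λ (_ : ⊤) → nil) (replicate m tt) ≡ encodeℕ m
encodeℕ-list zero    = refl
encodeℕ-list (suc m) = cong (nil ∙_) (encodeℕ-list m)

module Bounded (Q : ℕ) (2≤Q : 2 ≤ Q) where

  record Within (c : Command 2) (s : Store 2) (a : ℕ) (s′ : Store 2) : Set where
    constructor within
    field
      {duration} : ℕ
      duration≤  : duration ≤ Q ^ a
      derivation : c , s ⇓[ duration ] s′

  Q^-mono : ∀ {a b} → a ≤ b → Q ^ a ≤ Q ^ b
  Q^-mono = ℕ.^-monoʳ-≤ Q {{ℕ.>-nonZero (ℕ.≤-trans (s≤s z≤n) 2≤Q)}}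

  ≤Q^ : ∀ m → m ≤ Q ^ m
  ≤Q^ m = ℕ.≤-trans (ℕ.<⇒≤ (n<2^n m)) (ℕ.^-monoˡ-≤ m 2≤Q)

  double : ∀ {a} → Q ^ a ℕ.+ Q ^ a ≤ Q ^ suc a
  double {a} = ℕ.≤-trans (ℕ.+-monoʳ-≤ (Q ^ a) (ℕ.m≤m+n (Q ^ a) 0)) (ℕ.*-monoˡ-≤ (Q ^ a) 2≤Q)

  -- Both summands are at most `Q ^ (a ℕ.+ b)`, and doubling costs one more factor `Q`. Thus
  -- sequential composition only adds to exponents.
  ≤⊕ : ∀ {t u} a b → t ≤ Q ^ a → u ≤ Q ^ b → t ℕ.+ u ≤ Q ^ (a ⊕ b)
  ≤⊕ a b t≤ u≤ = ℕ.≤-trans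
    (ℕ.+-mono-≤ (ℕ.≤-trans t≤ (Q^-mono (ℕ.m≤m+n a b))) (ℕ.≤-trans u≤ (Q^-mono (ℕ.m≤n+m b a))))
    (double {a ℕ.+ b})

  assigns : ∀ x e {s} → Within (x ≔ e) s (suc (cost e)) (s Vec.[ x ]≔ ⟦ e ⟧ s)
  assigns x e = within (≤Q^ (suc (cost e))) assign

  infixr 5 _then_

  _then_ : ∀ {c d s s′ s″ a b} → Within c s a s′ → Within d s′ b s″ →
    Within (c ⨾ d) s (a ⊕ b) s″
  _then_ {a = a} {b} (within t≤ p) (within u≤ q) = within (≤⊕ a b t≤ u≤) (seq p q)

  -- σ ps ys is the store when ys remains to be processed and ps has been
  -- processed, in reverse order.

  module _ {A : Set} {e : Expr 2} {c : Command 2} (σ : List A → List A → Store 2) (total : List A) {b : ℕ}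
    (stop : ∀ ps → ⟦ e ⟧ (σ ps []) ≡ nil)
    (go : ∀ x ps ys → ∃₂ λ u v → ⟦ e ⟧ (σ ps (x ∷ ys)) ≡ u ∙ v)
    (step : ∀ x ps ys → ys ʳ++ (x ∷ ps) ≡ total → Within c (σ ps (x ∷ ys)) b (σ (x ∷ ps) ys)) where

    private
      a : ℕ
      a = suc (cost e) ⊕ b

    iterate : ∀ ps ys → ys ʳ++ ps ≡ total →
      ∃[ t ] t ≤ suc (length ys) ℕ.* Q ^ a × (while e loop c , σ ps ys ⇓[ t ] σ total [])
    iterate ps [] refl = suc (cost e) ,
      ℕ.≤-trans (ℕ.≤-trans (≤Q^ (suc (cost e))) (Q^-mono (ℕ.≤-trans (ℕ.m≤m+n (suc (cost e)) b) (ℕ.n≤1+n _))))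
        (ℕ.m≤m+n (Q ^ a) 0) ,
      while-false (stop ps)
    iterate ps (x ∷ ys) eq with step x ps ys eq | iterate (x ∷ ps) ys eq | go x ps ys
    ... | within {t} t≤ p | u , u≤ , q | _ , _ , nonnil = suc (cost e) ℕ.+ (t ℕ.+ u) ,
      ℕ.≤-trans (ℕ.≤-reflexive (sym (ℕ.+-assoc (suc (cost e)) t u)))
        (ℕ.+-mono-≤ (≤⊕ (suc (cost e)) b (≤Q^ (suc (cost e))) t≤) u≤) ,
      while-true nonnil p q

    iterates : ∀ ys → ys ʳ++ [] ≡ total → length ys ≤ Q →
      Within (while e loop c) (σ [] ys) (2 ℕ.+ a) (σ total [])
    iterates ys eq ys≤ with iterate [] ys eq
    ... | t , t≤ , p = within
      (ℕ.≤-trans t≤ (ℕ.≤-trans (ℕ.*-monoˡ-≤ (Q ^ a) suc≤) (ℕ.≤-reflexive (ℕ.*-assoc Q Q (Q ^ a))))) p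
      where
      suc≤ : suc (length ys) ≤ Q ℕ.* Q
      suc≤ = ℕ.≤-trans (ℕ.+-mono-≤ (ℕ.≤-trans (s≤s z≤n) 2≤Q) (ℕ.≤-trans ys≤ (ℕ.m≤m+n Q 0)))
        (ℕ.*-monoˡ-≤ Q 2≤Q)

  infix 3 _⊢_⇓_

  record _⊢_⇓_ (ρ : Tree) (t : Term) (y : Tree) : Set where
    constructor evaluates
    field run : ∀ st → Within (compile t) (ρ ∷ st ∷ []) (exponent t) (y ∷ st ∷ [])

  open _⊢_⇓_ public

  ⇓-resp : ∀ {ρ t y y′} → y ≡ y′ → ρ ⊢ t ⇓ y → ρ ⊢ t ⇓ y′
  ⇓-resp refl p = p

  ⇓-respˡ : ∀ {ρ ρ′ t y} → ρ ≡ ρ′ → ρ ⊢ t ⇓ y → ρ′ ⊢ t ⇓ y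
  ⇓-respˡ refl p = p

  ⇓-ret : ∀ {ρ} e → ρ ⊢ ret e ⇓ ⟦ e ⟧ (ρ ∷ [])
  run (⇓-ret {ρ} e) st = subst (λ y → Within _ _ _ (y ∷ st ∷ [])) (⟦embed⟧ e ρ st) (assigns zero (embed e))

  ⇓-on : ∀ {ρ t y} e → ⟦ e ⟧ (ρ ∷ []) ⊢ t ⇓ y → ρ ⊢ on e t ⇓ y
  run (⇓-on {ρ} e p) st = run (⇓-ret e) st then run p st

  ⇓-bind : ∀ {ρ x y} t u → ρ ⊢ t ⇓ x → (x ∙ ρ) ⊢ u ⇓ y → ρ ⊢ bind t u ⇓ y
  run (⇓-bind {ρ} t u p q) st =
    assigns (suc zero) _ then run p (ρ ∙ st) then assigns zero _ then assigns (suc zero) _ then run q st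

  ⇓-cond-true : ∀ {ρ y u v} e t t′ → ⟦ e ⟧ (ρ ∷ []) ≡ u ∙ v → ρ ⊢ t ⇓ y → ρ ⊢ cond e t t′ ⇓ y
  run (⇓-cond-true {ρ} e t t′ eq p) st with run p st
  ... | within τ≤ r = within
    (≤⊕ (suc (cost (embed e))) (exponent t ℕ.+ exponent t′) (≤Q^ (suc (cost (embed e))))
      (ℕ.≤-trans τ≤ (Q^-mono (ℕ.m≤m+n (exponent t) (exponent t′)))))
    (if-true (trans (⟦embed⟧ e ρ st) eq) r)

  ⇓-cond-false : ∀ {ρ y} e t t′ → ⟦ e ⟧ (ρ ∷ []) ≡ nil → ρ ⊢ t′ ⇓ y → ρ ⊢ cond e t t′ ⇓ y
  run (⇓-cond-false {ρ} e t t′ eq p) st with run p st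
  ... | within τ≤ r = within
    (≤⊕ (suc (cost (embed e))) (exponent t ℕ.+ exponent t′) (≤Q^ (suc (cost (embed e))))
      (ℕ.≤-trans τ≤ (Q^-mono (ℕ.m≤n+m (exponent t′) (exponent t)))))
    (if-false (trans (⟦embed⟧ e ρ st) eq) r)

  -- `G ps` is the accumulator once the suffix `ps` has been folded. The equation supplied to the
  -- body says that `x ∷ ps` is a suffix of `xs`, which yields membership and size bounds.
  ⇓-loop : ∀ {A : Set} {enc : A → Tree} {ρ} t (G : List A → Tree) xs → length xs ≤ Q →
    (∀ x ps ys → ys ʳ++ (x ∷ ps) ≡ xs → (enc x ∙ (G ps ∙ ρ)) ⊢ t ⇓ G (x ∷ ps)) →
    (encodeList enc xs ∙ (G [] ∙ ρ)) ⊢ loop t ⇓ G xs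
  run (⇓-loop {A} {enc} {ρ} t G xs xs≤ body) st =
    assigns zero _ then
    iterates (λ ps ys → ((encodeList enc ys ∙ encodeList enc ps) ∙ (G [] ∙ ρ)) ∷ st ∷ []) (reverse xs)
      (λ _ → refl) (λ _ _ _ → _ , _ , refl) (λ _ _ _ _ → assigns zero _) xs refl xs≤ then
    assigns zero _ then
    iterates (λ ps ys → (encodeList enc ys ∙ (G ps ∙ ρ)) ∷ st ∷ []) xs
      (λ _ → refl) (λ _ _ _ → _ , _ , refl)
      (λ x ps ys eq → assigns (suc zero) _ then assigns zero _ then run (body x ps ys eq) _ then
        assigns zero _ then assigns (suc zero) _)
      (reverse xs) (List.reverse-involutive xs)
      (ℕ.≤-trans (ℕ.≤-reflexive (List.length-reverse xs)) xs≤) then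
    assigns zero _

  -- A unary number is a list of `nil`, and the length of the processed suffix acts as the loop
  -- counter.
  ⇓-iterate : ∀ {ρ} t (G : ℕ → Tree) m → m ≤ Q →
    (∀ i → i < m → (nil ∙ (G i ∙ ρ)) ⊢ t ⇓ G (suc i)) →
    (encodeℕ m ∙ (G 0 ∙ ρ)) ⊢ loop t ⇓ G m
  ⇓-iterate {ρ} t G m m≤ body = subst₂ (λ x y → (x ∙ (G 0 ∙ ρ)) ⊢ loop t ⇓ G y)
    (encodeℕ-list m) (List.length-replicate m)
    (⇓-loop t (G ∘ length) (replicate m tt) (ℕ.≤-trans (ℕ.≤-reflexive (List.length-replicate m)) m≤)
      λ _ ps ys eq → body (length ps) (ℕ.≤-trans (length-ʳ++-≤ ys)
        (ℕ.≤-reflexive (trans (cong length eq) (List.length-replicate m)))))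

-- The reduction as a program

-- v i is the variable with de Bruijn index i.

environment : ℕ → Expr 1
environment zero    = var zero
environment (suc i) = tl (environment i)

v : ℕ → Expr 1
v i = hd (environment i)

trueᴱ : Expr 1
trueᴱ = cons nil nil

-- In the body `t`, `v 0` is the element, `v 1` the accumulator, and all outer indices are shifted
-- by two.
fold : Expr 1 → Expr 1 → Term → Term
fold xs b t = on (cons xs (cons b (var zero))) (loop t)

-- Since the tail of `nil` is `nil`, repeated tails compute truncated subtraction.
monusᵀ : Term
monusᵀ = fold (v 1) (v 0) (ret (tl (v 1)))

-- Tests only distinguish `nil` from other trees, so equality is decided by whether both truncated
-- differences vanish.
equalᵀ : Term
equalᵀ = bind monusᵀ (cond (v 0) (ret nil)
  (bind (on (cons (v 2) (cons (v 1) nil)) monusᵀ) (cond (v 0) (ret nil) (ret trueᴱ))))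

pointᵀ : Term
pointᵀ = fold (v 1) nil
  (bind (on (cons (tl (v 0)) (cons (v 2) nil)) equalᵀ) (cond (v 0) (ret trueᴱ) (ret (v 2))))

evᵀ : Term
evᵀ = fold (v 0) trueᴱ
  (bind (on (cons (tl (v 0)) (cons (v 3) nil)) pointᵀ)
    -- The outer test reads the sign of the literal. The accumulated product survives exactly when
    -- the literal is false at the point.
    (cond (hd (v 1)) (cond (v 0) (ret nil) (ret (v 2))) (cond (v 0) (ret (v 2)) (ret nil))))

entryᵀ : Term
entryᵀ = bind (on (cons (hd (v 1)) (cons (hd (v 2)) nil)) equalᵀ)
  (cond (v 0)
    (bind (on (cons (tl (v 2)) (cons (v 1) nil)) evᵀ)
      (cond (v 0) (on (cons (tl (v 4)) (cons (v 2) nil)) evᵀ) (ret nil)))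
    (ret nil))

rowᵀ : Term
rowᵀ = fold (v 2) nil
  (bind (on (cons (v 3) (cons (v 2) (cons (v 0) nil))) entryᵀ) (ret (cons (v 0) (v 2))))

matrixᵀ : Term
matrixᵀ = fold (v 1) nil
  (bind (on (cons (v 0) (cons (v 2) (cons (v 3) nil))) rowᵀ) (ret (cons (v 0) (v 2))))

matricesᵀ : Term
matricesᵀ = fold (v 0) nil
  (bind (on (cons (v 0) (cons (v 3) nil)) matrixᵀ) (ret (cons (v 0) (v 2))))

lengthᵀ : Term
lengthᵀ = fold (v 0) nil (ret (cons nil (v 1)))

literalsᵀ : Term
literalsᵀ = bind
  -- The accumulator pairs a counter with the list of literals whose variables lie below it.
  (fold (v 0) (cons nil nil)
    (ret (cons (cons nil (hd (v 1)))
      (cons (cons (cons nil nil) (hd (v 1))) (cons (cons nil (hd (v 1))) (tl (v 1)))))))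
  (ret (tl (v 0)))

wordsᵀ : Term
wordsᵀ = fold (v 0) (cons nil nil)
  (fold (v 3) (cons nil nil) (fold (v 3) (v 1) (ret (cons (cons (v 2) (v 0)) (v 1)))))

itemsᵀ : Term
itemsᵀ = bind (fold (v 2) nil (ret (cons (cons nil (v 0)) (v 1))))
  (fold (v 1) (v 0) (fold (v 4) (v 1) (fold (v 7) (v 1)
    -- A clause has exactly three literals, so they are prepended one by one without a further loop.
    (ret (cons (cons (v 4) (cons (hd (v 2)) (cons (hd (tl (v 2))) (cons (hd (tl (tl (v 2)))) (v 0))))) (v 1))))))

-- The initial environment lists `d`, `L`, the labels, `n` and the clauses. The successive results
-- are the literals, the words up to length `d`, those up to length `L`, the items, their number,
-- and the matrices.
mainᵀ : Term
mainᵀ =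
  bind (on (cons (v 3) nil) literalsᵀ)
  (bind (on (cons (v 1) (cons (v 0) nil)) wordsᵀ)
  (bind (on (cons (v 3) (cons (v 1) nil)) wordsᵀ)
  (bind (on (cons (v 5) (cons (v 7) (cons (v 1) nil))) itemsᵀ)
  (bind (on (cons (v 0) nil) lengthᵀ)
  (bind (on (cons (v 2) (cons (v 1) nil)) matricesᵀ)
  (ret (cons (v 1) (v 0))))))))

-- Correctness of the program

encodeBool : Bool → Tree
encodeBool b = encodeF₂ (fromBool b)

encodeWord : ∀ {n} → Word n → Tree
encodeWord = encodeList encodeLiteral

encodeItem : ∀ {n} → Item n → Tree
encodeItem (i , S) = encodeℕ i ∙ encodeWord S

tail-encodeℕ : ∀ m → tail (encodeℕ m) ≡ encodeℕ (ℕ.pred m)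
tail-encodeℕ zero    = refl
tail-encodeℕ (suc m) = refl

tail-encodeLiteral : ∀ {n} (l : Literal n) → tail (encodeLiteral l) ≡ encodeFin (variableOf l)
tail-encodeLiteral (pos x) = refl
tail-encodeLiteral (neg x) = refl

module Programs (Q : ℕ) (2≤Q : 2 ≤ Q) where

  open Bounded Q 2≤Q

  ⇓-monus : ∀ {x y ρ} → y ≤ Q → (encodeℕ x ∙ (encodeℕ y ∙ ρ)) ⊢ monusᵀ ⇓ encodeℕ (x ∸ y)
  ⇓-monus {x} {y} y≤ = ⇓-on _ (⇓-iterate _ (λ i → encodeℕ (x ∸ i)) y y≤ λ i _ →
    ⇓-resp
      (trans (tail-encodeℕ (x ∸ i)) (cong encodeℕ (ℕ.pred[m∸n]≡m∸[1+n] x i))) (⇓-ret _))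

  ⇓-equal : ∀ {x y ρ} → x ≤ Q → y ≤ Q → (encodeℕ x ∙ (encodeℕ y ∙ ρ)) ⊢ equalᵀ ⇓ encodeBool (x ≡ᵇ y)
  ⇓-equal {x} {y} {ρ} x≤ y≤ = ⇓-bind monusᵀ _ (⇓-monus y≤) (first (x ∸ y) refl)
    where
    second : ∀ z → y ∸ x ≡ z → x ∸ y ≡ 0 →
      (encodeℕ z ∙ (nil ∙ (encodeℕ x ∙ (encodeℕ y ∙ ρ)))) ⊢ cond (v 0) (ret nil) (ret trueᴱ) ⇓ encodeBool (x ≡ᵇ y)
    second zero eq eq′ rewrite ≡ᵇ-true {x} {y} (ℕ.≤-antisym (ℕ.m∸n≡0⇒m≤n eq′) (ℕ.m∸n≡0⇒m≤n eq)) =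
      ⇓-cond-false _ _ _ refl (⇓-ret _)
    second (suc z) eq eq′
      rewrite ≡ᵇ-false {x} {y} (λ x≡y → ℕ.0≢1+n (trans (sym (ℕ.m≤n⇒m∸n≡0 (ℕ.≤-reflexive (sym x≡y)))) eq)) =
      ⇓-cond-true _ _ _ refl (⇓-ret _)

    first : ∀ z → x ∸ y ≡ z → (encodeℕ z ∙ (encodeℕ x ∙ (encodeℕ y ∙ ρ))) ⊢
      cond (v 0) (ret nil) (bind (on (cons (v 2) (cons (v 1) nil)) monusᵀ) (cond (v 0) (ret nil) (ret trueᴱ))) ⇓
      encodeBool (x ≡ᵇ y)
    first zero    eq = ⇓-cond-false _ _ _ refl
      (⇓-bind _ _ (⇓-on _ (⇓-monus x≤)) (second (y ∸ x) refl eq))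
    first (suc z) eq
      rewrite ≡ᵇ-false {x} {y} (λ x≡y → ℕ.0≢1+n (trans (sym (ℕ.m≤n⇒m∸n≡0 (ℕ.≤-reflexive x≡y))) eq)) =
      ⇓-cond-true _ _ _ refl (⇓-ret _)

  Fin≤Q : ∀ {n} → n ≤ Q → (x : Fin n) → toℕ x ≤ Q
  Fin≤Q n≤ x = ℕ.≤-trans (ℕ.<⇒≤ (Fin.toℕ<n x)) n≤

  ⇓-point : ∀ {n ρ} (x : Fin n) W → n ≤ Q → length W ≤ Q →
    (encodeFin x ∙ (encodeWord W ∙ ρ)) ⊢ pointᵀ ⇓ encodeBool (point W x)
  ⇓-point x W n≤ W≤ = ⇓-on _ (⇓-loop _ (λ ps → encodeBool (point ps x)) W W≤ λ l ps _ _ →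
    ⇓-bind _ _
      (⇓-on _ (⇓-respˡ (cong (_∙ (encodeFin x ∙ nil)) (sym (tail-encodeLiteral l)))
        (⇓-equal (Fin≤Q n≤ (variableOf l)) (Fin≤Q n≤ x))))
      (choose (toℕ (variableOf l) ≡ᵇ toℕ x) (point ps x)))
    where
    choose : ∀ b c {l ρ} → (encodeBool b ∙ (l ∙ (encodeBool c ∙ ρ))) ⊢
      cond (v 0) (ret trueᴱ) (ret (v 2)) ⇓ encodeBool (b ∨ c)
    choose true  c = ⇓-cond-true _ _ _ refl (⇓-ret _)
    choose false c = ⇓-cond-false _ _ _ refl (⇓-ret _)

  ⇓-ev : ∀ {n ρ} (S W : Word n) → n ≤ Q → length S ≤ Q → length W ≤ Q →
    (encodeWord S ∙ (encodeWord W ∙ ρ)) ⊢ evᵀ ⇓ encodeF₂ (ev (point W) S)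
  ⇓-ev {n} S W n≤ S≤ W≤ = ⇓-on _ (⇓-loop _ (λ ps → encodeF₂ (ev (point W) ps)) S S≤ λ l ps _ _ →
    ⇓-bind _ _
      (⇓-on _ (⇓-respˡ (cong (_∙ (encodeWord W ∙ nil)) (sym (tail-encodeLiteral l)))
        (⇓-point (variableOf l) W n≤ W≤)))
      (multiply l (ev (point W) ps)))
    where
    multiply : ∀ (l : Literal n) p {ρ} →
      (encodeBool (point W (variableOf l)) ∙ (encodeLiteral l ∙ (encodeF₂ p ∙ ρ))) ⊢
      cond (hd (v 1)) (cond (v 0) (ret nil) (ret (v 2))) (cond (v 0) (ret (v 2)) (ret nil)) ⇓
      encodeF₂ (factor (point W) l * p)
    multiply (pos x) p with point W x
    ... | true  = ⇓-cond-true _ _ _ refl (⇓-cond-true _ _ _ refl (⇓-ret _))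
    ... | false = ⇓-cond-true _ _ _ refl (⇓-cond-false _ _ _ refl (⇓-ret _))
    multiply (neg x) p with point W x
    ... | true  = ⇓-cond-false _ _ _ refl (⇓-cond-true _ _ _ refl (⇓-ret _))
    ... | false = ⇓-cond-false _ _ _ refl (⇓-cond-false _ _ _ refl (⇓-ret _))

  Small : ∀ {n} → Item n → Set
  Small (i , S) = i ≤ Q × length S ≤ Q

  ⇓-entry : ∀ {n ρ} (W : Word n) x y → n ≤ Q → length W ≤ Q → Small x → Small y →
    (encodeWord W ∙ (encodeItem x ∙ (encodeItem y ∙ ρ))) ⊢ entryᵀ ⇓ encodeF₂ (entry W x y)
  ⇓-entry {ρ = ρ} W (i , S) (j , T) n≤ W≤ (i≤ , S≤) (j≤ , T≤) =
    ⇓-bind _ _ (⇓-on _ (⇓-equal i≤ j≤)) (compare (i ≡ᵇ j))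
    where
    multiply : ∀ p {e} →
      (encodeF₂ p ∙ (e ∙ (encodeWord W ∙ (encodeItem (i , S) ∙ (encodeItem (j , T) ∙ ρ))))) ⊢
      cond (v 0) (on (cons (tl (v 4)) (cons (v 2) nil)) evᵀ) (ret nil) ⇓ encodeF₂ (p * ev (point W) T)
    multiply 0ℙ = ⇓-cond-false _ _ _ refl (⇓-ret _)
    multiply 1ℙ = ⇓-cond-true _ _ _ refl (⇓-on _ (⇓-ev T W n≤ T≤ W≤))

    compare : ∀ b → (encodeBool b ∙ (encodeWord W ∙ (encodeItem (i , S) ∙ (encodeItem (j , T) ∙ ρ)))) ⊢
      cond (v 0)
        (bind (on (cons (tl (v 2)) (cons (v 1) nil)) evᵀ)
          (cond (v 0) (on (cons (tl (v 4)) (cons (v 2) nil)) evᵀ) (ret nil)))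
        (ret nil) ⇓
      encodeF₂ (fromBool b * (ev (point W) S * ev (point W) T))
    compare false = ⇓-cond-false _ _ _ refl (⇓-ret _)
    compare true  = ⇓-cond-true _ _ _ refl
      (⇓-bind _ _ (⇓-on _ (⇓-ev S W n≤ S≤ W≤)) (multiply (ev (point W) S)))

  ⇓-map : ∀ {A : Set} {enc : A → Tree} {ρ t} (f : A → Tree) xs → length xs ≤ Q →
    (∀ x → x ∈ xs → ∀ {acc} → (enc x ∙ (acc ∙ ρ)) ⊢ t ⇓ f x) →
    (encodeList enc xs ∙ (nil ∙ ρ)) ⊢ loop (bind t (ret (cons (v 0) (v 2)))) ⇓ encodeList f xs
  ⇓-map f xs xs≤ p = ⇓-loop _ (encodeList f) xs xs≤ λ x ps ys eq →
    ⇓-bind _ _ (p x (subst (x ∈_) eq (∈-ʳ++ ys (here refl)))) (⇓-ret _)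

  ⇓-matrices : ∀ {n} {Ws : List (Word n)} {its ρ} → n ≤ Q →
    length Ws ≤ Q → (∀ W → W ∈ Ws → length W ≤ Q) → length its ≤ Q → (∀ x → x ∈ its → Small x) →
    (encodeList encodeWord Ws ∙ (encodeList encodeItem its ∙ ρ)) ⊢ matricesᵀ ⇓
    encodeList (λ W → encodeList (λ x → encodeList (λ y → encodeF₂ (entry W x y)) its) its) Ws
  ⇓-matrices {Ws = Ws} {its} n≤ Ws≤ Ws-small its≤ its-small =
    ⇓-on _ (⇓-map _ Ws Ws≤ λ W W∈ → ⇓-on _
      (⇓-on _ (⇓-map _ its its≤ λ x x∈ → ⇓-on _
        (⇓-on _ (⇓-map _ its its≤ λ y y∈ → ⇓-on _
          (⇓-entry W x y n≤ (Ws-small W W∈) (its-small x x∈) (its-small y y∈)))))))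

  ⇓-length : ∀ {A : Set} {enc : A → Tree} {ρ} xs → length xs ≤ Q →
    (encodeList enc xs ∙ ρ) ⊢ lengthᵀ ⇓ encodeℕ (length xs)
  ⇓-length xs xs≤ = ⇓-on _ (⇓-loop _ (encodeℕ ∘ length) xs xs≤ λ _ _ _ _ → ⇓-ret _)

  ⇓-literals : ∀ {n ρ} → n ≤ Q → (encodeℕ n ∙ ρ) ⊢ literalsᵀ ⇓ encodeWord (literals n)
  ⇓-literals {n} n≤ = ⇓-bind _ _
    (⇓-on _ (⇓-iterate _ (λ m → encodeℕ m ∙ below m) n n≤ λ _ _ → ⇓-ret _))
    (⇓-resp (below≡ n ℕ.≤-refl) (⇓-ret _))
    where
    below : ℕ → Tree
    below zero    = nil
    below (suc m) = ((nil ∙ nil) ∙ encodeℕ m) ∙ ((nil ∙ encodeℕ m) ∙ below m)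

    below≡ : ∀ m (m≤n : m ≤ n) → below m ≡ encodeWord (literalsBelow m m≤n)
    below≡ zero    _   = refl
    below≡ (suc m) m<n = cong₂ (λ x y → ((nil ∙ nil) ∙ encodeℕ x) ∙ ((nil ∙ encodeℕ x) ∙ y))
      (sym (Fin.toℕ-fromℕ< m<n)) (below≡ m (ℕ.<⇒≤ m<n))

  -- The explicit tail `b` lets nested loops prepend to one common accumulator, so that lists are
  -- never concatenated at run time.
  ⇓-concatMap : ∀ {A B : Set} {enc : A → Tree} {encᴮ : B → Tree} {ρ t} 
    (f : A → List B) xs b → length xs ≤ Q →
    (∀ x acc → (enc x ∙ (encodeList encᴮ acc ∙ ρ)) ⊢ t ⇓ encodeList encᴮ (f x ++ acc)) →
    (encodeList enc xs ∙ (encodeList encᴮ b ∙ ρ)) ⊢ loop t ⇓ encodeList encᴮ (concatMap f xs ++ b)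
  ⇓-concatMap {encᴮ = encᴮ} f xs b xs≤ p =
    ⇓-loop _ (λ ps → encodeList encᴮ (concatMap f ps ++ b)) xs xs≤ λ x ps _ _ →
    ⇓-resp (cong (encodeList encᴮ) (sym (List.++-assoc (f x) (concatMap f ps) b))) (p x (concatMap f ps ++ b))

  ⇓-map-++ : ∀ {A B : Set} {enc : A → Tree} {encᴮ : B → Tree} {ρ e} (f : A → B) xs b → length xs ≤ Q →
    (∀ x {acc} → ⟦ e ⟧ ((enc x ∙ (acc ∙ ρ)) ∷ []) ≡ encᴮ (f x)) →
    (encodeList enc xs ∙ (encodeList encᴮ b ∙ ρ)) ⊢ loop (ret (cons e (v 1))) ⇓ encodeList encᴮ (map f xs ++ b)
  ⇓-map-++ {encᴮ = encᴮ} {e = e} f xs b xs≤ p =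
    ⇓-loop _ (λ ps → encodeList encᴮ (map f ps ++ b)) xs xs≤ λ x ps _ _ →
    ⇓-resp (cong (_∙ encodeList encᴮ (map f ps ++ b)) (p x)) (⇓-ret (cons e (v 1)))

  ⇓-words : ∀ {n ρ} {ls : List (Literal n)} d → d ≤ Q → length ls ≤ Q →
    (∀ i → i < d → length (words ls i) ≤ Q) →
    (encodeℕ d ∙ (encodeWord ls ∙ ρ)) ⊢ wordsᵀ ⇓ encodeList encodeWord (words ls d)
  ⇓-words {ls = ls} d d≤ ls≤ ws≤ = ⇓-on _ (⇓-iterate _ (λ i → encodeList encodeWord (words ls i)) d d≤ λ i i<d →
    ⇓-on _ (⇓-concatMap {encᴮ = encodeWord} (λ l → map (l ∷_) (words ls i)) ls ([] ∷ []) ls≤ λ l acc →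
      ⇓-on _ (⇓-map-++ {encᴮ = encodeWord} (l ∷_) (words ls i) acc (ws≤ i i<d) λ _ → refl)))

  ⇓-items : ∀ {n ρ} (Ks : List ℕ) (cls : List (Clause n)) (ws : List (Word n)) →
    length Ks ≤ Q → length cls ≤ Q → length ws ≤ Q →
    (encodeList encodeℕ Ks ∙ (encodeList encodeClause cls ∙ (encodeList encodeWord ws ∙ ρ))) ⊢ itemsᵀ ⇓
    encodeList encodeItem
      (concatMap (λ i → concatMap (λ C → map (λ q → i , Vec.toList C ++ q) ws) cls) Ks ++ map (0 ,_) ws)
  ⇓-items {ρ = ρ} Ks cls ws Ks≤ cls≤ ws≤ = ⇓-bind _ _
    (⇓-on _ (⇓-map-++ {encᴮ = encodeItem} (0 ,_) ws [] ws≤ λ _ → refl))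
    (⇓-respˡ (cong (λ y → encodeList encodeItem y ∙ ρ′) (sym (List.++-identityʳ (map (0 ,_) ws))))
      (⇓-on _ (⇓-concatMap {encᴮ = encodeItem} (λ i → concatMap (multiples i) cls) Ks _ Ks≤ λ i acc →
        ⇓-on _ (⇓-concatMap {encᴮ = encodeItem} (multiples i) cls acc cls≤ λ { C@(_ ∷ _ ∷ _ ∷ []) acc′ →
          ⇓-on _ (⇓-map-++ {encᴮ = encodeItem} (λ q → i , Vec.toList C ++ q) ws acc′ ws≤ λ _ → refl) }))))
    where
    multiples : ℕ → Clause _ → List (Item _)
    multiples i C = map (λ q → i , Vec.toList C ++ q) ws
    ρ′ : Tree
    ρ′ = encodeList encodeℕ Ks ∙ (encodeList encodeClause cls ∙ (encodeList encodeWord ws ∙ ρ))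

  module _ {n : ℕ} (φ : 3CNF n) (K d L : ℕ) (n≤ : n ≤ Q) (K≤ : K ≤ Q) (d≤L : 3 ℕ.+ d ≤ L) (L≤ : L ≤ Q)
    (ls≤ : length (literals n) ≤ Q) (ws≤ : ∀ i → i ≤ L → length (words (literals n) i) ≤ Q)
    (cls≤ : length (3CNF.clauses φ) ≤ Q) (its≤ : length (items φ K d) ≤ Q) where

    ⇓-main : (encodeℕ d ∙ (encodeℕ L ∙ (encodeList encodeℕ (applyUpTo suc K) ∙ (encodeℕ n ∙
        (encodeList encodeClause (3CNF.clauses φ) ∙ nil))))) ⊢ mainᵀ ⇓
      (encodeℕ (length (items φ K d)) ∙
        encodeList (λ W → encodeList (λ x → encodeList (λ y → encodeF₂ (entry W x y)) (items φ K d)) (items φ K d))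
          (words (literals n) L))
    ⇓-main =
      ⇓-bind _ _ (⇓-on _ (⇓-literals n≤))
      (⇓-bind _ _ (⇓-on _ (⇓-words d (ℕ.≤-trans d≤ L≤) ls≤ λ i i<d → ws≤ i (ℕ.≤-trans (ℕ.<⇒≤ i<d) d≤)))
      (⇓-bind _ _ (⇓-on _ (⇓-words L L≤ ls≤ λ i i<L → ws≤ i (ℕ.<⇒≤ i<L)))
      (⇓-bind _ _ (⇓-on _ (⇓-items (applyUpTo suc K) (3CNF.clauses φ) (words (literals n) d)
        (ℕ.≤-trans (ℕ.≤-reflexive (List.length-applyUpTo suc K)) K≤) cls≤ (ws≤ d d≤)))
      (⇓-bind _ _ (⇓-on _ (⇓-length (items φ K d) its≤))
      (⇓-bind _ _ (⇓-on _ (⇓-matrices n≤ (ws≤ L ℕ.≤-refl)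
        (λ W W∈ → ℕ.≤-trans (words-length (literals n) L W∈) L≤) its≤ λ x x∈ → small (items-valid φ K d x∈)))
      (⇓-ret _))))))
      where
      d≤ : d ≤ L
      d≤ = ℕ.≤-trans (ℕ.m≤n+m d 3) d≤L
      small : ∀ {x} → Valid φ K d x → Small x
      small w@(main _)          = z≤n , ℕ.≤-trans (length-item w) (ℕ.≤-trans d≤L L≤)
      small w@(penalty i<K _ _) = ℕ.≤-trans i<K K≤ , ℕ.≤-trans (length-item w) (ℕ.≤-trans d≤L L≤)

encodeVector-lookup : ∀ {A B : Set} (g : B → Tree) (f : A → Tree) xs (h : Vector B (length xs)) →
  (∀ i → g (h i) ≡ f (lookup xs i)) → encodeVector g h ≡ encodeList f xs
encodeVector-lookup g f []       h eq = refl
encodeVector-lookup g f (x ∷ xs) h eq = cong₂ _∙_ (eq zero) (encodeVector-lookup g f xs (h ∘ suc) (eq ∘ suc))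

encodeSpan-generators : ∀ {n} (φ : 3CNF n) K d L → encodeSpan (generators φ K d L) ≡
  encodeℕ (length (items φ K d)) ∙
    encodeList (λ W → encodeList (λ x → encodeList (λ y → encodeF₂ (entry W x y)) (items φ K d)) (items φ K d))
      (words (literals n) L)
encodeSpan-generators {n} φ K d L = cong (encodeℕ (length (items φ K d)) ∙_)
  (encodeVector-lookup _ _ (words (literals n) L) _ λ w →
    encodeVector-lookup _ _ (items φ K d) _ λ i →
      encodeVector-lookup _ _ (items φ K d) _ λ j → refl)

k<2^log : ∀ k → k < 2 ^ suc ⌊log₂ k ⌋
k<2^log k = ℕ.≰⇒> λ 2^≤k → ℕ.1+n≰n (ℕ.≤-trans
  (ℕ.≤-reflexive (sym (⌊log₂[2^n]⌋≡n (suc ⌊log₂ k ⌋)))) (⌊log₂⌋-mono-≤ 2^≤k))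

-- Sizes and running times

lookup-injective : ∀ {A : Set} {xs : List A} → Unique xs → ∀ i j → lookup xs i ≡ lookup xs j → i ≡ j
lookup-injective (x∉ ∷ u) zero    zero    eq = refl
lookup-injective (x∉ ∷ u) zero    (suc j) eq = contradiction eq (All.lookup x∉ (∈-lookup j))
lookup-injective (x∉ ∷ u) (suc i) zero    eq = contradiction (sym eq) (All.lookup x∉ (∈-lookup i))
lookup-injective (x∉ ∷ u) (suc i) (suc j) eq = cong suc (lookup-injective u i j eq)

literalCode : ∀ {n} → Literal n → Fin (n ℕ.+ n)
literalCode {n} (pos x) = join n n (inj₁ x)
literalCode {n} (neg x) = join n n (inj₂ x)

literalCode-injective : ∀ {n} {l l′ : Literal n} → literalCode l ≡ literalCode l′ → l ≡ l′
literalCode-injective {n} {l} {l′} eq = decode l l′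
  (trans (sym (Fin.splitAt-join n n _))
    (trans (cong (splitAt n) (trans (code l) (trans eq (sym (code l′))))) (Fin.splitAt-join n n _)))
  where
  summand : Literal n → Fin n ⊎ Fin n
  summand (pos x) = inj₁ x
  summand (neg x) = inj₂ x
  code : ∀ l → join n n (summand l) ≡ literalCode l
  code (pos x) = refl
  code (neg x) = refl
  decode : ∀ l l′ → summand l ≡ summand l′ → l ≡ l′
  decode (pos x) (pos y) eq = cong pos (inj₁-injective eq)
  decode (neg x) (neg y) eq = cong neg (inj₂-injective eq)

clauseCode : ∀ {n} → Clause n → Fin ((n ℕ.+ n) ^ 3)
clauseCode C = funToFin (literalCode ∘ Vec.lookup C)

clauseCode-injective : ∀ {n} {C C′ : Clause n} → clauseCode C ≡ clauseCode C′ → C ≡ C′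
clauseCode-injective {C = C} {C′} eq = trans (sym (Vec.tabulate∘lookup C))
  (trans (Vec.tabulate-cong {f = Vec.lookup C} {Vec.lookup C′} λ i → literalCode-injective (begin
    literalCode (Vec.lookup C i)    ≡⟨ Fin.finToFun-funToFin (literalCode ∘ Vec.lookup C) i ⟨
    finToFun (clauseCode C) i       ≡⟨ cong (λ c → finToFun c i) eq ⟩
    finToFun (clauseCode C′) i      ≡⟨ Fin.finToFun-funToFin (literalCode ∘ Vec.lookup C′) i ⟩
    literalCode (Vec.lookup C′ i)   ∎))
  (Vec.tabulate∘lookup C′))
  where open ≡-Reasoning

-- The clauses of a formula are distinct, so their codes embed the positions of the list into
-- `Fin ((n ℕ.+ n) ^ 3)`.
length-clauses : ∀ {n} (φ : 3CNF n) → length (3CNF.clauses φ) ≤ (n ℕ.+ n) ^ 3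
length-clauses φ = Fin.injective⇒≤ {f = clauseCode ∘ lookup (3CNF.clauses φ)}
  λ eq → lookup-injective (3CNF.unique φ) _ _ (clauseCode-injective eq)

length-literals : ∀ {n} m (m≤n : m ≤ n) → length (literalsBelow m m≤n) ≡ m ℕ.+ m
length-literals zero    _   = refl
length-literals (suc m) m<n = cong suc (trans (cong suc (length-literals m (ℕ.<⇒≤ m<n))) (sym (ℕ.+-suc m m)))

length-concatMap : ∀ {A B : Set} {c} (f : A → List B) → (∀ x → length (f x) ≡ c) → ∀ xs →
  length (concatMap f xs) ≡ length xs ℕ.* c
length-concatMap f eq []       = refl
length-concatMap f eq (x ∷ xs) = trans (List.length-++ (f x)) (cong₂ ℕ._+_ (eq x) (length-concatMap f eq xs))

length-words : ∀ {A : Set} (ls : List A) d → length (words ls d) ≤ suc (length ls) ^ d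
length-words ls zero    = s≤s z≤n
length-words ls (suc d) = begin
  length (concatMap (λ l → map (l ∷_) (words ls d)) ls ++ [] ∷ [])
    ≡⟨ List.length-++ (concatMap (λ l → map (l ∷_) (words ls d)) ls) ⟩
  length (concatMap (λ l → map (l ∷_) (words ls d)) ls) ℕ.+ 1
    ≡⟨ cong (ℕ._+ 1) (length-concatMap (λ l → map (l ∷_) (words ls d))
         (λ l → List.length-map (l ∷_) (words ls d)) ls) ⟩
  length ls ℕ.* length (words ls d) ℕ.+ 1
    ≤⟨ ℕ.+-mono-≤ (ℕ.*-monoʳ-≤ (length ls) (length-words ls d)) (ℕ.m^n>0 (suc (length ls)) d) ⟩
  length ls ℕ.* suc (length ls) ^ d ℕ.+ suc (length ls) ^ d
    ≡⟨ ℕ.+-comm (length ls ℕ.* suc (length ls) ^ d) (suc (length ls) ^ d) ⟩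
  suc (length ls) ^ suc d ∎
  where open ℕ.≤-Reasoning

length-items : ∀ {n} (φ : 3CNF n) K d → length (items φ K d) ≡
  K ℕ.* (length (3CNF.clauses φ) ℕ.* length (words (literals n) d)) ℕ.+ length (words (literals n) d)
length-items {n} φ K d = trans (List.length-++ (penalties (3CNF.clauses φ) K ws)) (cong₂ ℕ._+_
  (trans
    (length-concatMap _ (λ i → length-concatMap _ (λ C → List.length-map _ ws) (3CNF.clauses φ)) (applyUpTo suc K))
    (cong (ℕ._* _) (List.length-applyUpTo suc K)))
  (List.length-map {B = Item n} (0 ,_) ws))
  where
  ws : List (Word n)
  ws = words (literals n) d

-- The complete program and its running time

constant : Tree → Expr 2
constant nil     = nil
constant (x ∙ y) = cons (constant x) (constant y)

⟦constant⟧ : ∀ x s → ⟦ constant x ⟧ s ≡ x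
⟦constant⟧ nil     s = refl
⟦constant⟧ (x ∙ y) s = cong₂ _∙_ (⟦constant⟧ x s) (⟦constant⟧ y s)

-- The parameters that depend on `k` alone are hard-wired into the program; the cost of building
-- them is part of the running time.
initial : ℕ → ℕ → ℕ → Expr 2
initial K d L = cons (constant (encodeℕ d)) (cons (constant (encodeℕ L))
  (cons (constant (encodeList encodeℕ (applyUpTo suc K)))
  (cons (hd (var zero)) (cons (tl (var zero)) nil))))

reductionProgram : ℕ → ℕ → ℕ → Program
reductionProgram K d L = record { body = (zero ≔ initial K d L) ⨾ compile mainᵀ }

-- Each `0` pays for a unit cost, each `4` for a unary number, the first `7` for the list of labels
-- and the last for unpacking the input. Neither exponent depends on `k`, which makes the final
-- constant uniform.
initialExponent totalExponent : ℕ
initialExponent = 0 ⊕ (0 ⊕ (4 ⊕ (0 ⊕ (4 ⊕ (0 ⊕ (7 ⊕ 7))))))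
totalExponent   = initialExponent ⊕ exponent mainᵀ

module Startup (Q : ℕ) (2≤Q : 2 ≤ Q) where
  open Bounded Q 2≤Q
  open Programs Q 2≤Q

  1≤Q^0 : 1 ≤ Q ^ 0
  1≤Q^0 = s≤s z≤n

  cost-cons : ∀ (e f : Expr 2) a b → cost e ≤ Q ^ a → cost f ≤ Q ^ b → cost (cons e f) ≤ Q ^ (0 ⊕ (a ⊕ b))
  cost-cons e f a b e≤ f≤ = ≤⊕ 0 (a ⊕ b) 1≤Q^0 (≤⊕ a b e≤ f≤)

  ≤Q^1 : ∀ {m} → m ≤ Q → m ≤ Q ^ 1
  ≤Q^1 m≤ = ℕ.≤-trans m≤ (ℕ.≤-reflexive (sym (ℕ.*-identityʳ Q)))

  cost-encodeℕ : ∀ m → cost (constant (encodeℕ m)) ≡ 1 ℕ.+ (m ℕ.+ m)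
  cost-encodeℕ zero    = refl
  cost-encodeℕ (suc m) = cong suc (trans (cong suc (cost-encodeℕ m)) (cong suc (sym (ℕ.+-suc m m))))

  cost-encodeℕ≤ : ∀ {m} → m ≤ Q → cost (constant (encodeℕ m)) ≤ Q ^ 4
  cost-encodeℕ≤ {m} m≤ = ℕ.≤-trans (ℕ.≤-reflexive (cost-encodeℕ m)) (≤⊕ 0 3 1≤Q^0 (≤⊕ 1 1 (≤Q^1 m≤) (≤Q^1 m≤)))

  cost-encodeList : ∀ {A : Set} {enc : A → Tree} {xs c} → All (λ x → cost (constant (enc x)) ≤ c) xs →
    cost (constant (encodeList enc xs)) ≤ 1 ℕ.+ length xs ℕ.* suc c
  cost-encodeList []                     = s≤s z≤n
  cost-encodeList {enc = enc} {x ∷ xs} {c} (x≤ ∷ xs≤) = s≤s (begin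
    cost (constant (enc x)) ℕ.+ cost (constant (encodeList enc xs)) ≤⟨ ℕ.+-mono-≤ x≤ (cost-encodeList xs≤) ⟩
    c ℕ.+ (1 ℕ.+ length xs ℕ.* suc c)                               ≡⟨ ℕ.+-suc c _ ⟩
    suc c ℕ.+ length xs ℕ.* suc c                                   ∎)
    where open ℕ.≤-Reasoning

  cost-labels : ∀ {K} → K ≤ Q → cost (constant (encodeList encodeℕ (applyUpTo suc K))) ≤ Q ^ 7
  cost-labels {K} K≤ = ℕ.≤-trans
    (cost-encodeList (All.applyUpTo⁺₁ suc K (λ i<K → cost-encodeℕ≤ (ℕ.≤-trans i<K K≤))))
    (≤⊕ 0 6 1≤Q^0 (ℕ.*-mono-≤ (ℕ.≤-trans (ℕ.≤-reflexive (List.length-applyUpTo suc K)) K≤)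
      (≤⊕ 0 4 1≤Q^0 ℕ.≤-refl)))

  cost-initial : ∀ {K d L} → K ≤ Q → d ≤ Q → L ≤ Q → suc (cost (initial K d L)) ≤ Q ^ initialExponent
  cost-initial {K} {d} {L} K≤ d≤ L≤ = ≤⊕ 0 (0 ⊕ (4 ⊕ (0 ⊕ (4 ⊕ (0 ⊕ (7 ⊕ 7)))))) 1≤Q^0
    (cost-cons (constant (encodeℕ d)) e₂ 4 (0 ⊕ (4 ⊕ (0 ⊕ (7 ⊕ 7)))) (cost-encodeℕ≤ d≤)
      (cost-cons (constant (encodeℕ L)) e₁ 4 (0 ⊕ (7 ⊕ 7)) (cost-encodeℕ≤ L≤)
        (cost-cons (constant (encodeList encodeℕ (applyUpTo suc K))) e₀ 7 7 (cost-labels K≤) (≤Q^ 7))))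
    where
    e₀ e₁ e₂ : Expr 2
    e₀ = cons (hd (var zero)) (cons (tl (var zero)) nil)
    e₁ = cons (constant (encodeList encodeℕ (applyUpTo suc K))) e₀
    e₂ = cons (constant (encodeℕ L)) e₁

  halts : ∀ {c x y z a} → Within c (x ∷ nil ∷ []) a (y ∷ nil ∷ []) → y ≡ z →
    ∃[ t ] (record { body = c } ⟨ x ⟩⇓[ t ] z) × t ≤ Q ^ a
  halts (within t≤ p) y≡z = _ , (_ , p , y≡z) , t≤

  module _ {n : ℕ} (φ : 3CNF n) (K d L : ℕ) (n≤ : n ≤ Q) (K≤ : K ≤ Q) (d≤L : 3 ℕ.+ d ≤ L) (L≤ : L ≤ Q)
    (ls≤ : length (literals n) ≤ Q) (ws≤ : ∀ i → i ≤ L → length (words (literals n) i) ≤ Q)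
    (cls≤ : length (3CNF.clauses φ) ≤ Q) (its≤ : length (items φ K d) ≤ Q) where

    reduction-runs : ∃[ t ] (reductionProgram K d L ⟨ encode3CNF φ ⟩⇓[ t ] encodeSpan (generators φ K d L)) ×
      t ≤ Q ^ totalExponent
    reduction-runs = halts (start then run (⇓-main φ K d L n≤ K≤ d≤L L≤ ls≤ ws≤ cls≤ its≤) nil)
      (sym (encodeSpan-generators φ K d L))
      where
      start : Within (zero ≔ initial K d L) (encode3CNF φ ∷ nil ∷ []) initialExponent
        ((encodeℕ d ∙ (encodeℕ L ∙ (encodeList encodeℕ (applyUpTo suc K) ∙ (encodeℕ n ∙
          (encodeList encodeClause (3CNF.clauses φ) ∙ nil))))) ∷ nil ∷ [])
      start = within (cost-initial K≤ (ℕ.≤-trans (ℕ.m≤n+m d 3) (ℕ.≤-trans d≤L L≤)) L≤)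
        (subst
          (λ y → (zero ≔ initial K d L) , (encode3CNF φ ∷ nil ∷ []) ⇓[ suc (cost (initial K d L)) ] (y ∷ nil ∷ []))
          (cong₂ _∙_ (⟦constant⟧ (encodeℕ d) _) (cong₂ _∙_ (⟦constant⟧ (encodeℕ L) _)
            (cong₂ _∙_ (⟦constant⟧ (encodeList encodeℕ (applyUpTo suc K)) _) refl)))
          assign)

-- Choice of the parameters

module Parameters (n k : ℕ) where

  -- There are at most z ^ (4 * L) words of length L, and L ≤ 10 * J; this
  -- is where 40 comes from.

  z J d L K Q : ℕ
  z = n ⊔ 2
  J = suc ⌊log₂ k ⌋
  d = suc J
  L = (3 ℕ.+ d) ℕ.+ (3 ℕ.+ d)
  K = suc k
  Q = z ^ (40 ℕ.* J)

  2≤z : 2 ≤ z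
  2≤z = ℕ.m≤n⊔m n 2

  open Bounded z 2≤z using (≤⊕; ≤Q^) renaming (Q^-mono to z^-mono)

  ^1 : ∀ m → m ≡ m ^ 1
  ^1 m = sym (ℕ.*-identityʳ m)

  ≤z^J* : ∀ {m} c → m ≤ c → m ≤ c ℕ.* J
  ≤z^J* c m≤ = ℕ.≤-trans m≤ (ℕ.m≤m*n c J)

  n≤z^1 : n ≤ z ^ 1
  n≤z^1 = ℕ.≤-trans (ℕ.m≤m⊔n n 2) (ℕ.≤-reflexive (^1 z))

  ≤Q : ∀ {m a} → m ≤ z ^ a → a ≤ 40 ℕ.* J → m ≤ Q
  ≤Q m≤ a≤ = ℕ.≤-trans m≤ (z^-mono a≤)

  n≤Q : n ≤ Q
  n≤Q = ≤Q n≤z^1 (≤z^J* 40 (s≤s z≤n))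

  2≤Q : 2 ≤ Q
  2≤Q = ≤Q (ℕ.≤-trans 2≤z (ℕ.≤-reflexive (^1 z))) (≤z^J* 40 (s≤s z≤n))

  K≤z^J : K ≤ z ^ J
  K≤z^J = ℕ.≤-trans (k<2^log k) (ℕ.^-monoˡ-≤ J 2≤z)

  K≤Q : K ≤ Q
  K≤Q = ≤Q K≤z^J (ℕ.m≤n*m J 40)

  d≤2J : d ≤ 2 ℕ.* J
  d≤2J = ℕ.+-mono-≤ {1} {J} (s≤s z≤n) (ℕ.m≤m+n J 0)

  L≤10J : L ≤ 10 ℕ.* J
  L≤10J = ℕ.≤-trans (ℕ.+-mono-≤ half half) (ℕ.≤-reflexive (sym (ℕ.*-distribʳ-+ J 5 5)))
    where
    half : 3 ℕ.+ d ≤ 5 ℕ.* J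
    half = ℕ.≤-trans (ℕ.+-mono-≤ (≤z^J* 3 ℕ.≤-refl) d≤2J) (ℕ.≤-reflexive (sym (ℕ.*-distribʳ-+ J 3 2)))

  L≤Q : L ≤ Q
  L≤Q = ≤Q (≤Q^ L) (ℕ.≤-trans L≤10J (ℕ.*-monoˡ-≤ J (ℕ.m≤m+n 10 30)))

  literals≤ : suc (length (literals n)) ≤ z ^ 4
  literals≤ = ≤⊕ 0 3 (s≤s z≤n) (ℕ.≤-trans (ℕ.≤-reflexive (length-literals n ℕ.≤-refl)) (≤⊕ 1 1 n≤z^1 n≤z^1))

  literals≤Q : length (literals n) ≤ Q
  literals≤Q = ≤Q (ℕ.≤-trans (ℕ.n≤1+n _) literals≤) (≤z^J* 40 (ℕ.m≤m+n 4 36))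

  words≤ : ∀ i → length (words (literals n) i) ≤ z ^ (4 ℕ.* i)
  words≤ i = ℕ.≤-trans (length-words (literals n) i)
    (ℕ.≤-trans (ℕ.^-monoˡ-≤ i literals≤) (ℕ.≤-reflexive (ℕ.^-*-assoc z 4 i)))

  words≤Q : ∀ i → i ≤ L → length (words (literals n) i) ≤ Q
  words≤Q i i≤L = ≤Q (words≤ i) (ℕ.≤-trans (ℕ.*-monoʳ-≤ 4 (ℕ.≤-trans i≤L L≤10J))
    (ℕ.≤-reflexive (sym (ℕ.*-assoc 4 10 J))))

  words-d≤ : length (words (literals n) d) ≤ z ^ (8 ℕ.* J)
  words-d≤ = ℕ.≤-trans (words≤ d) (z^-mono (ℕ.≤-trans (ℕ.*-monoʳ-≤ 4 d≤2J) (ℕ.≤-reflexive (sym (ℕ.*-assoc 4 2 J)))))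

  module _ (φ : 3CNF n) where

    clauses≤ : length (3CNF.clauses φ) ≤ z ^ (9 ℕ.* J)
    clauses≤ = ℕ.≤-trans (length-clauses φ)
      (ℕ.≤-trans (ℕ.^-monoˡ-≤ 3 (≤⊕ 1 1 n≤z^1 n≤z^1))
        (ℕ.≤-trans (ℕ.≤-reflexive (ℕ.^-*-assoc z 3 3)) (z^-mono (≤z^J* 9 ℕ.≤-refl))))

    clauses≤Q : length (3CNF.clauses φ) ≤ Q
    clauses≤Q = ≤Q clauses≤ (ℕ.*-monoˡ-≤ J (ℕ.m≤m+n 9 31))

    items≤Q : length (items φ K d) ≤ Q
    -- The penalties need exponent `(1 + 9 + 8) J`, for labels, clauses and words, and the main
    -- items `8 J`. With one more `J` for the sum this is `27 J`, below `40 J`.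
    items≤Q = ≤Q (ℕ.≤-trans (ℕ.≤-reflexive (length-items φ K d)) (≤⊕ (18 ℕ.* J) (8 ℕ.* J) penalties≤ words-d≤))
      (ℕ.≤-trans (≤-step (18 ℕ.* J ℕ.+ 8 ℕ.* J)) (ℕ.≤-trans
        (ℕ.+-monoʳ-≤ J (ℕ.≤-reflexive (sym (ℕ.*-distribʳ-+ J 18 8))))
        (ℕ.*-monoˡ-≤ J (ℕ.m≤m+n 27 13))))
      where
      ≤-step : ∀ m → suc m ≤ J ℕ.+ m
      ≤-step m = ℕ.+-monoˡ-≤ m {1} {J} (s≤s z≤n)
      penalties≤ : K ℕ.* (length (3CNF.clauses φ) ℕ.* length (words (literals n) d)) ≤ z ^ (18 ℕ.* J)
      penalties≤ = ℕ.≤-trans (ℕ.*-mono-≤ K≤z^J (ℕ.*-mono-≤ clauses≤ words-d≤)) (ℕ.≤-reflexive (begin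
        z ^ J ℕ.* (z ^ (9 ℕ.* J) ℕ.* z ^ (8 ℕ.* J))  ≡⟨ cong (z ^ J ℕ.*_) (ℕ.^-distribˡ-+-* z (9 ℕ.* J) (8 ℕ.* J)) ⟨
        z ^ J ℕ.* z ^ (9 ℕ.* J ℕ.+ 8 ℕ.* J)          ≡⟨ cong (λ a → z ^ J ℕ.* z ^ a) (ℕ.*-distribʳ-+ J 9 8) ⟨
        z ^ J ℕ.* z ^ (17 ℕ.* J)                     ≡⟨ ℕ.^-distribˡ-+-* z J (17 ℕ.* J) ⟨
        z ^ (18 ℕ.* J)                               ∎))
        where open ≡-Reasoning

  Q^≡bound : ∀ e → Q ^ e ≡ bound (40 ℕ.* e) k n
  Q^≡bound e = trans (ℕ.^-*-assoc z (40 ℕ.* J) e) (cong (z ^_) (begin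
    40 ℕ.* J ℕ.* e     ≡⟨ ℕ.*-assoc 40 J e ⟩
    40 ℕ.* (J ℕ.* e)   ≡⟨ cong (40 ℕ.*_) (ℕ.*-comm J e) ⟩
    40 ℕ.* (e ℕ.* J)   ≡⟨ ℕ.*-assoc 40 e J ⟨
    40 ℕ.* e ℕ.* J     ∎))
    where open ≡-Reasoning

  Q≤bound : ∀ e → 1 ≤ e → Q ≤ bound (40 ℕ.* e) k n
  Q≤bound e 1≤e = ℕ.≤-trans (ℕ.≤-reflexive (^1 Q))
    (ℕ.≤-trans (ℕ.^-monoʳ-≤ Q {{ℕ.>-nonZero (ℕ.≤-trans (s≤s z≤n) 2≤Q)}} 1≤e) (ℕ.≤-reflexive (Q^≡bound e)))

1≤totalExponent : 1 ≤ totalExponent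
1≤totalExponent = s≤s z≤n

theorem3p11 :
    ∃[ c ] ∀ (k : ℕ) → 1 ≤ k →
      ∃ λ (reduction : Program) → ∀ (n : ℕ) (φ : 3CNF n) →
        ∃[ t ] ∃[ N ] ∃[ m ] ∃ λ (B : Vector (Matrix N) m) →
          (reduction ⟨ encode3CNF φ ⟩⇓[ t ] encodeSpan B)
          × t ≤ bound c k n
          × N ≤ bound c k n
          × (Satisfiable φ →
               ∃[ M ] Span B M × NonZeroVector M × HasRank M 1)
          × (¬ Satisfiable φ →
               ¬ (∃[ M ] Span B M × NonZeroVector M × RankAtMost M k))
-- Sizes and loop lengths are at most `Q`, which is `(n ⊔ 2) ^ (40 ℕ.* J)`, and the time is at most
-- `Q ^ totalExponent`; the product of the two exponents gives the constant.
theorem3p11 = 40 ℕ.* totalExponent , λ k _ →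
  let J = suc ⌊log₂ k ⌋
      d = suc J
      L = (3 ℕ.+ d) ℕ.+ (3 ℕ.+ d)
  in reductionProgram (suc k) d L , λ n φ →
    let open Parameters n k
          using (Q; 2≤Q; n≤Q; K≤Q; L≤Q; literals≤Q; words≤Q; clauses≤Q; items≤Q; Q^≡bound; Q≤bound)
        t , runs , t≤ = Startup.reduction-runs Q 2≤Q φ (suc k) d L n≤Q K≤Q (ℕ.m≤m+n (3 ℕ.+ d) (3 ℕ.+ d)) L≤Q
          literals≤Q words≤Q (clauses≤Q φ) (items≤Q φ)
    in t , length (items φ (suc k) d) , length (words (literals n) L) , generators φ (suc k) d L ,
       runs ,
       ℕ.≤-trans t≤ (ℕ.≤-reflexive (Q^≡bound totalExponent)) ,
       ℕ.≤-trans (items≤Q φ) (Q≤bound totalExponent 1≤totalExponent) ,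
       (λ (α , sat) → satisfiable⇒rank-1 φ {suc k} {d} {L} α sat ℕ.≤-refl) ,
       -- The choices `suc k` and `suc J` are the least with `k < K` and `J < d`, and `J` is large
       -- enough for `k < 2 ^ J`.
       λ { unsat (M , (a , M≗) , nonZero , rank≤k) → nonZero
         (unsatisfiable⇒zero φ {k} {suc k} {d} {J} {L} unsat ℕ.≤-refl (k<2^log k) ℕ.≤-refl M a M≗ rank≤k) }
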